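{- Let $k\ge 1$ and let $C_{2k+1}$ be an edge-ordered cycle on $2k+1$ vertices (with any edge-ordering). Then \[sat_e(n,C_{2k+1})=\Theta(n)\quad\text{and}\quad ssat_e(n,C_{2k+1})=\Theta(n).\]
   Context: An edge-ordered graph is a finite simple graph together with a linear order on its edge set (usually given by an injective labeling $l:E\to\mathbb{N}$ or $l:E\to\mathbb{R}$). An edge-ordered graph $H$ contains $G$ (has a copy of $G$) if $G$ is isomorphic, by an isomorphism respecting the edge-order, to a subgraph of $H$ with the induced order; otherwise $H$ is $G$-free. $ssat_e(n,G)$ is the minimum number of edges in an edge-ordered graph $H$ on $n$ vertices such that adding to $H$ any missing edge, inserted at an arbitrary position of the linear order of the edges, creates a new copy of $G$ (one using the added edge); that is, for every missing edge and every position a new copy is created. $sat_e(n,G)$ is defined in the same way with the additional requirement that $H$ is $G$-free. Asymptotic notation is for $n\to\infty$ with the edge-ordered graph $G$ fixed. -}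

module Defs where

open import Data.Fin using (Fin; toℕ; punchIn; punchOut) renaming (_<_ to _<ᶠ_)
open import Data.Fin.Permutation using (Permutation′; _⟨$⟩ʳ_)
open import Data.Fin.Properties using (punchIn-punchOut) renaming (_≟_ to _≟ᶠ_)
open import Data.Nat using (ℕ; suc; _*_; _%_; _≤_; NonZero)
open import Data.Product using (Σ-syntax; ∃-syntax; _×_; _,_; proj₁; proj₂; map; swap)
open import Data.Sum using (_⊎_; inj₁; inj₂)
open import Data.Vec using (Vec; lookup; insertAt)
open import Data.Vec.Properties using (insertAt-lookup; insertAt-punchIn)
open import Function using (_⇔_; Injective)
open import Relation.Binary.PropositionalEquality
  using (_≡_; _≢_; refl; sym; trans; cong; subst; subst₂)
open import Relation.Nullary using (¬_; yes; no; contradiction)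

------------------------------------------------------------------------
-- Edge-ordered graphs

SameEdge : ∀ {n} → Fin n × Fin n → Fin n × Fin n → Set
SameEdge e e′ = e ≡ e′ ⊎ e ≡ swap e′

SameEdge-sym : ∀ {n} {e e′ : Fin n × Fin n} → SameEdge e e′ → SameEdge e′ e
SameEdge-sym (inj₁ p) = inj₁ (sym p)
SameEdge-sym (inj₂ p) = inj₂ (cong swap (sym p))

-- A finite simple graph on the vertex set Fin n with a linearly ordered
-- edge set.  The edges are listed, without repetition, in increasing
-- order, so the label of an edge is its index in the list.  Each edge
-- {u, v} is listed as one of the pairs (u , v), (v , u).
record EdgeOrderedGraph (n : ℕ) : Set where
  field
    size     : ℕ
    edges    : Vec (Fin n × Fin n) size
    loopless : ∀ i → proj₁ (lookup edges i) ≢ proj₂ (lookup edges i)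
    distinct : Injective _≡_ SameEdge (lookup edges)

open EdgeOrderedGraph public

Adj : ∀ {n} → EdgeOrderedGraph n → Fin n → Fin n → Set
Adj H u v = ∃[ i ] SameEdge (lookup (edges H) i) (u , v)

-- The graph H plus the missing edge {u, v}, placed in the edge-order so
-- that exactly the first p edges of H precede it.
addEdge : ∀ {n} (H : EdgeOrderedGraph n) {u v : Fin n} →
          u ≢ v → ¬ Adj H u v → Fin (suc (size H)) → EdgeOrderedGraph n
addEdge {n} H {u} {v} u≢v ¬uv p = record
  { size     = suc (size H)
  ; edges    = es
  ; loopless = loop
  ; distinct = dist _ _
  }
  where
  es : Vec (Fin n × Fin n) (suc (size H))
  es = insertAt (edges H) p (u , v)

  new : lookup es p ≡ (u , v)
  new = insertAt-lookup (edges H) p (u , v)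

  old : ∀ {i} (p≢i : p ≢ i) → lookup es i ≡ lookup (edges H) (punchOut p≢i)
  old p≢i = trans (cong (lookup es) (sym (punchIn-punchOut p≢i)))
                  (insertAt-punchIn (edges H) p (u , v) (punchOut p≢i))

  loop : ∀ i → proj₁ (lookup es i) ≢ proj₂ (lookup es i)
  loop i with p ≟ᶠ i
  ... | yes refl = subst (λ e → proj₁ e ≢ proj₂ e) (sym new) u≢v
  ... | no p≢i   = subst (λ e → proj₁ e ≢ proj₂ e) (sym (old p≢i))
                         (loopless H (punchOut p≢i))

  dist : ∀ i j → SameEdge (lookup es i) (lookup es j) → i ≡ j
  dist i j s with p ≟ᶠ i | p ≟ᶠ j
  ... | yes refl | yes refl = refl
  ... | yes refl | no p≢j   =
    contradiction (_ , SameEdge-sym (subst₂ SameEdge new (old p≢j) s)) ¬uv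
  ... | no p≢i   | yes refl =
    contradiction (_ , subst₂ SameEdge (old p≢i) new s) ¬uv
  ... | no p≢i   | no p≢j   =
    trans (sym (punchIn-punchOut p≢i))
      (trans (cong (punchIn p) (distinct H (subst₂ SameEdge (old p≢i) (old p≢j) s)))
             (punchIn-punchOut p≢j))

------------------------------------------------------------------------
-- Copies

-- A copy of G in H is a (not necessarily induced) subgraph of H that is
-- the image of G under an injection of vertices which preserves the
-- order of the edges.
record Copy {m n} (G : EdgeOrderedGraph m) (H : EdgeOrderedGraph n) : Set where
  field
    vmap      : Fin m → Fin n
    injective : Injective _≡_ _≡_ vmap
    emap      : Fin (size G) → Fin (size H)
    incidence : ∀ i → SameEdge (lookup (edges H) (emap i))
                               (map vmap vmap (lookup (edges G) i))
    monotone  : ∀ {i j} → i <ᶠ j → emap i <ᶠ emap j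

Uses : ∀ {m n} {G : EdgeOrderedGraph m} {H : EdgeOrderedGraph n} →
       Copy G H → Fin (size H) → Set
Uses c p = ∃[ i ] Copy.emap c i ≡ p

_-Free : ∀ {m n} → EdgeOrderedGraph m → EdgeOrderedGraph n → Set
(G -Free) H = ¬ Copy G H

------------------------------------------------------------------------
-- Saturation

Semisaturated : ∀ {m n} → EdgeOrderedGraph m → EdgeOrderedGraph n → Set
Semisaturated G H =
  ∀ {u v} (u≢v : u ≢ v) (¬uv : ¬ Adj H u v) (p : Fin (suc (size H))) →
  Σ[ c ∈ Copy G (addEdge H u≢v ¬uv p) ] Uses c p

Saturated : ∀ {m n} → EdgeOrderedGraph m → EdgeOrderedGraph n → Set
Saturated G H = (G -Free) H × Semisaturated G H

-- s is the minimum number of edges among the graphs on n vertices that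
-- satisfy P.
IsMinSize : ∀ {n} → (EdgeOrderedGraph n → Set) → ℕ → Set
IsMinSize P s = (∃[ H ] P H × size H ≡ s) × (∀ H → P H → s ≤ size H)

-- The minima are given as relations: Is-sat n G s says that sat_e(n, G)
-- exists and equals s, and similarly for ssat_e.
Is-sat : ∀ {m} → ℕ → EdgeOrderedGraph m → ℕ → Set
Is-sat n G = IsMinSize {n} (Saturated G)

Is-ssat : ∀ {m} → ℕ → EdgeOrderedGraph m → ℕ → Set
Is-ssat n G = IsMinSize {n} (Semisaturated G)

------------------------------------------------------------------------
-- Cycles

CyclicallyAdjacent : ∀ {n} .{{_ : NonZero n}} → Fin n → Fin n → Set
CyclicallyAdjacent {n} u v =
  toℕ v ≡ suc (toℕ u) % n ⊎ toℕ u ≡ suc (toℕ v) % n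

-- The underlying graph is isomorphic to the cycle on n vertices (for
-- n ≥ 3); the edge-order is unrestricted.
IsCycle : ∀ {n} .{{_ : NonZero n}} → EdgeOrderedGraph n → Set
IsCycle {n} G = Σ[ π ∈ Permutation′ n ]
  (∀ u v → Adj G (π ⟨$⟩ʳ u) (π ⟨$⟩ʳ v) ⇔ CyclicallyAdjacent u v)

------------------------------------------------------------------------
-- Asymptotics

-- Since C ranges over upper bounds, natural numbers C give the same
-- notion as positive reals.
infix 4 _=O_ _=Θ_

_=O_ : (ℕ → ℕ) → (ℕ → ℕ) → Set
f =O g = ∃[ C ] ∃[ N ] ∀ n → N ≤ n → f n ≤ C * g n

_=Θ_ : (ℕ → ℕ) → (ℕ → ℕ) → Set
f =Θ g = f =O g × g =O f

{-# OPTIONS --safe #-}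
module Submission where

-- Any C-free graph H₀ extends greedily to a saturated graph H, since inserting an
-- edge that completes no copy of C keeps the graph C-free.  If every new edge inside
-- a vertex set W, at any position, completes a copy of C, then H has at most d n
-- edges outside H₀, where d is the number of vertices outside W.  So it suffices to
-- find such an H₀ with O(n) edges and d constant.  For the triangle, a star will do.
-- For a longer odd cycle, delete an edge xy and blow up both x and y to the same
-- set W: the result is bipartite, hence C-free, and a new edge of W together
-- with one copy of each remaining edge restores the cycle.  Doing this twice, first
-- with xy the last edge of C and then, with all edges later, with xy the first edge
-- of C, covers all positions of the new edge.
--
-- For the lower bound, a copy of C through a new edge uv uses a second edge at u or
-- v, so a semisaturated graph has at most one isolated vertex.

open import Defs
open import Data.Bool using (Bool; true; false; not)
open import Data.Bool.Properties using (not-involutive; not-¬; ¬-not)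
open import Data.Empty using (⊥; ⊥-elim)
open import Data.Fin using (Fin; zero; suc; toℕ; fromℕ; fromℕ<; cast; punchIn; punchOut; combine; remQuot; splitAt; _↑ˡ_; _↑ʳ_; finToFun; funToFin) renaming (_<_ to _<ᶠ_)
open import Data.Fin.Permutation using (_⟨$⟩ʳ_; _⟨$⟩ˡ_; inverseˡ; inverseʳ)
open import Data.Fin.Properties as Finₚ using (any?; all?; injective⇒≤) renaming (_≟_ to _≟ᶠ_; _<?_ to _<ᶠ?_)
open import Data.Nat using (ℕ; zero; suc; _+_; _*_; _^_; _%_; _≤_; _<_; z≤n; s≤s)
open import Data.Nat.DivMod using (m%n<n; m<n⇒m%n≡m; n%n≡0)
import Data.Nat.Properties as ℕₚ
open import Data.Product using (Σ-syntax; ∃-syntax; ∃; _×_; _,_; proj₁; proj₂; map; swap; uncurry)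
open import Data.Product.Properties using (≡-dec)
open import Data.Sum using (_⊎_; inj₁; inj₂; [_,_]′)
open import Data.Sum.Function.Propositional using (_⊎-↔_)
open import Data.Unit using (⊤; tt)
open import Data.Vec using (Vec; []; lookup; tabulate)
open import Data.Vec.Properties using (insertAt-lookup; insertAt-punchIn; lookup∘tabulate; tabulate∘lookup; tabulate-cong)
open import Function using (_∘_; id; Injective; _↔_; Inverse; Equivalence)
open import Function.Construct.Composition using (_↔-∘_)
open import Function.Construct.Identity using (↔-id)
open import Function.Construct.Symmetry using (↔-sym)
open import Relation.Binary.Definitions using (Tri; tri<; tri≈; tri>)
open import Relation.Binary.PropositionalEquality hiding (respˡ; respʳ)
open import Relation.Nullary using (¬_; Dec; yes; no; contradiction; _×-dec_; _⊎-dec_; _→-dec_; ¬?)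
open import Relation.Nullary.Decidable using (map′; decidable-stable)
open import Relation.Unary using (Decidable)

private variable
  a b m n s : ℕ

-- Unoriented edges, strictly monotone maps and counting by codes.

edge : (H : EdgeOrderedGraph n) → Fin (size H) → Fin n × Fin n
edge H = lookup (edges H)

SameEdge-trans : {e e′ e″ : Fin n × Fin n} → SameEdge e e′ → SameEdge e′ e″ → SameEdge e e″
SameEdge-trans (inj₁ refl) q           = q
SameEdge-trans (inj₂ refl) (inj₁ refl) = inj₂ refl
SameEdge-trans (inj₂ refl) (inj₂ refl) = inj₁ refl

SameEdge-map : (f : Fin m → Fin n) {e e′ : Fin m × Fin m} →
               SameEdge e e′ → SameEdge (map f f e) (map f f e′)
SameEdge-map f (inj₁ refl) = inj₁ refl
SameEdge-map f (inj₂ refl) = inj₂ refl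

_≟ᵉ_ : (e e′ : Fin n × Fin n) → Dec (e ≡ e′)
_≟ᵉ_ = ≡-dec _≟ᶠ_ _≟ᶠ_

SameEdge? : (e e′ : Fin n × Fin n) → Dec (SameEdge e e′)
SameEdge? e e′ = (e ≟ᵉ e′) ⊎-dec (e ≟ᵉ swap e′)

Adj-sym : (H : EdgeOrderedGraph n) {u v : Fin n} → Adj H u v → Adj H v u
Adj-sym H (i , q) = i , SameEdge-trans q (inj₂ refl)

Adj-irrefl : (H : EdgeOrderedGraph n) {u v : Fin n} → Adj H u v → u ≢ v
Adj-irrefl H (i , inj₁ q) refl = loopless H i (trans (cong proj₁ q) (sym (cong proj₂ q)))
Adj-irrefl H (i , inj₂ q) refl = loopless H i (trans (cong proj₁ q) (sym (cong proj₂ q)))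

Adj? : (H : EdgeOrderedGraph n) (u v : Fin n) → Dec (Adj H u v)
Adj? H u v = any? λ i → SameEdge? (edge H i) (u , v)

strictMono⇒injective : {f : Fin a → Fin b} → (∀ {i j} → i <ᶠ j → f i <ᶠ f j) →
                       Injective _≡_ _≡_ f
strictMono⇒injective {f = f} mono {i} {j} eq with Finₚ.<-cmp i j
... | tri< i<j _ _ = contradiction eq (Finₚ.<⇒≢ (mono i<j))
... | tri≈ _ i≡j _ = i≡j
... | tri> _ _ j<i = contradiction (sym eq) (Finₚ.<⇒≢ (mono j<i))

strictMono⇒reflects : {f : Fin a → Fin b} → (∀ {i j} → i <ᶠ j → f i <ᶠ f j) →
                      ∀ {i j} → f i <ᶠ f j → i <ᶠ j
strictMono⇒reflects {f = f} mono {i} {j} lt with Finₚ.<-cmp i j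
... | tri< i<j _ _ = i<j
... | tri≈ _ refl _ = contradiction lt (ℕₚ.<-irrefl refl)
... | tri> _ _ j<i = contradiction (mono j<i) (ℕₚ.<-asym lt)

-- Choosing a code for each element gives an injection, because a code determines its element. Codes
-- form a relation since an element may have several. Every edge and vertex count below is of this
-- kind.
pigeonhole : {A : Set} → A ↔ Fin b → (R : Fin a → A → Set) →
             (∀ x → ∃ (R x)) → (∀ {x y c} → R x c → R y c → x ≡ y) → a ≤ b
pigeonhole A↔b R total inj = injective⇒≤ λ {x} {y} eq →
  inj (subst (R x) (to-injective eq) (proj₂ (total x))) (proj₂ (total y))
  where
  to-injective : Injective _≡_ _≡_ (Inverse.to A↔b)
  to-injective eq = trans (sym (Inverse.strictlyInverseʳ A↔b _))
                      (trans (cong (Inverse.from A↔b) eq) (Inverse.strictlyInverseʳ A↔b _))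

-- This crude bound makes the greedy extension stop.
size≤n² : (H : EdgeOrderedGraph n) → size H ≤ n * n
size≤n² H = pigeonhole (↔-sym Finₚ.*↔×) (λ i e → edge H i ≡ e) (λ i → _ , refl)
  λ p q → distinct H (inj₁ (trans p (sym q)))

-- Copies depend on the edge list only, not on the proofs stored in the graphs.
relocate : {G : EdgeOrderedGraph m} {es : Vec (Fin n × Fin n) s}
           {l l′ : ∀ i → proj₁ (lookup es i) ≢ proj₂ (lookup es i)}
           {d d′ : Injective _≡_ SameEdge (lookup es)} →
           Copy G (record { size = s ; edges = es ; loopless = l ; distinct = d }) →
           Copy G (record { size = s ; edges = es ; loopless = l′ ; distinct = d′ })
relocate c = record { Copy c }

-- Finite search for copies, graphs and minima

-- Functions are enumerated through their numerical codes. Decoding recovers a function only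
-- pointwise, hence the invariance assumed of `P`.
anyFunction? : {P : (Fin a → Fin b) → Set} →
               (∀ {f g} → f ≗ g → P f → P g) → Decidable P → Dec (∃ P)
anyFunction? resp P? = map′
  (λ (k , p) → finToFun k , p)
  (λ (f , p) → funToFin f , resp (sym ∘ Finₚ.finToFun-funToFin f) p)
  (any? (P? ∘ finToFun))

module _ (G : EdgeOrderedGraph m) (H : EdgeOrderedGraph n) where

  -- The side condition lets a single search serve both for arbitrary copies and for copies through
  -- a given edge.
  CopyWith : ((Fin (size G) → Fin (size H)) → Set) → Set
  CopyWith Q = Σ[ c ∈ Copy G H ] Q (Copy.emap c)

  private
    IsEmbedding : (Fin m → Fin n) → (Fin (size G) → Fin (size H)) → Set
    IsEmbedding f g =
      (∀ i j → f i ≡ f j → i ≡ j) ×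
      (∀ i → SameEdge (edge H (g i)) (map f f (edge G i))) ×
      (∀ i j → i <ᶠ j → g i <ᶠ g j)

    respˡ : ∀ {f f′ g} → f ≗ f′ → IsEmbedding f g → IsEmbedding f′ g
    respˡ eq (inj , inc , mono) =
      (λ i j p → inj i j (trans (eq i) (trans p (sym (eq j))))) ,
      (λ i → SameEdge-trans (inc i) (inj₁ (cong₂ _,_ (eq _) (eq _)))) ,
      mono

    respʳ : ∀ {f g g′} → g ≗ g′ → IsEmbedding f g → IsEmbedding f g′
    respʳ eq (inj , inc , mono) =
      inj ,
      (λ i → subst (λ j → SameEdge (edge H j) _) (eq i) (inc i)) ,
      (λ i j → subst₂ _<ᶠ_ (eq i) (eq j) ∘ mono i j)

    IsEmbedding? : ∀ f g → Dec (IsEmbedding f g)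
    IsEmbedding? f g =
      (all? λ i → all? λ j → (f i ≟ᶠ f j) →-dec (i ≟ᶠ j)) ×-dec
      (all? λ i → SameEdge? _ _) ×-dec
      (all? λ i → all? λ j → (i <ᶠ? j) →-dec (g i <ᶠ? g j))

  copyWith? : {Q : (Fin (size G) → Fin (size H)) → Set} →
              (∀ {g g′} → g ≗ g′ → Q g → Q g′) → Decidable Q → Dec (CopyWith Q)
  copyWith? {Q} resp Q? = map′
    (λ (f , g , (inj , inc , mono) , q) →
      record { vmap = f ; injective = inj _ _ ; emap = g
             ; incidence = inc ; monotone = mono _ _ } , q)
    (λ (c , q) → let open Copy c in
      vmap , emap , ((λ _ _ → injective) , incidence , (λ _ _ → monotone)) , q)
    (anyFunction? (λ eq (g , e , q) → g , respˡ eq e , q) λ f →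
     anyFunction? (λ eq (e , q) → respʳ eq e , resp eq q) λ g →
     IsEmbedding? f g ×-dec Q? g)

  copy? : Dec (Copy G H)
  copy? = map′ proj₁ (_, tt) (copyWith? {Q = λ _ → ⊤} (λ _ _ → tt) (λ _ → yes tt))

  usingCopy? : ∀ p → Dec (Σ[ c ∈ Copy G H ] Uses c p)
  usingCopy? p = copyWith? (λ eq (i , q) → i , trans (sym (eq i)) q)
    (λ g → any? λ i → g i ≟ᶠ p)

-- The failure of semisaturation in positive form: a witness is an edge that the greedy extension
-- may insert next.
Unblocked : EdgeOrderedGraph m → EdgeOrderedGraph n → Set
Unblocked G H = ∃[ u ] ∃[ v ] ∃[ p ] Σ[ u≢v ∈ u ≢ v ] Σ[ ¬uv ∈ ¬ Adj H u v ]
  ¬ (Σ[ c ∈ Copy G (addEdge H u≢v ¬uv p) ] Uses c p)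

unblocked? : (G : EdgeOrderedGraph m) (H : EdgeOrderedGraph n) → Dec (Unblocked G H)
unblocked? G H = any? λ u → any? λ v → any? λ p → dec u v p
  where
  dec : ∀ u v p → Dec (Σ[ u≢v ∈ u ≢ v ] Σ[ ¬uv ∈ ¬ Adj H u v ]
                       ¬ (Σ[ c ∈ Copy G (addEdge H u≢v ¬uv p) ] Uses c p))
  dec u v p with u ≟ᶠ v | Adj? H u v
  ... | yes u≡v | _      = no λ (u≢v , _) → u≢v u≡v
  ... | no _    | yes uv = no λ (_ , ¬uv , _) → ¬uv uv
  ... | no u≢v  | no ¬uv with usingCopy? G (addEdge H u≢v ¬uv p) p
  -- The proofs bound by this pattern may differ from the decided ones, so the two extended graphs
  -- share only their edge lists.
  ...   | yes (c , use) = no λ (_ , _ , none) → none (relocate c , use)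
  ...   | no none       = yes (u≢v , ¬uv , none)

blocked⇒semisaturated : (G : EdgeOrderedGraph m) (H : EdgeOrderedGraph n) →
                        ¬ Unblocked G H → Semisaturated G H
blocked⇒semisaturated G H blocked u≢v ¬uv p =
  decidable-stable (usingCopy? G _ p) λ none → blocked (_ , _ , p , u≢v , ¬uv , none)

semisaturated? : (G : EdgeOrderedGraph m) (H : EdgeOrderedGraph n) → Dec (Semisaturated G H)
semisaturated? G H with unblocked? G H
... | yes (_ , _ , p , u≢v , ¬uv , none) = no λ semi → none (semi u≢v ¬uv p)
... | no blocked = yes (blocked⇒semisaturated G H blocked)

saturated? : (G : EdgeOrderedGraph m) (H : EdgeOrderedGraph n) → Dec (Saturated G H)
saturated? G H = ¬? (copy? G H) ×-dec semisaturated? G H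

-- Independence of the stored proofs. The search below runs over edge lists and obtains these proofs
-- anew by decision.
OnEdgeList : (EdgeOrderedGraph n → Set) → Set
OnEdgeList {n} P = ∀ {s} {es : Vec (Fin n × Fin n) s}
  {l l′ : ∀ i → proj₁ (lookup es i) ≢ proj₂ (lookup es i)}
  {d d′ : Injective _≡_ SameEdge (lookup es)} →
  P (record { size = s ; edges = es ; loopless = l ; distinct = d }) →
  P (record { size = s ; edges = es ; loopless = l′ ; distinct = d′ })

semisaturated-onEdgeList : (G : EdgeOrderedGraph m) → OnEdgeList {n} (Semisaturated G)
semisaturated-onEdgeList G semi u≢v ¬uv p =
  let c , use = semi u≢v ¬uv p in relocate c , use

saturated-onEdgeList : (G : EdgeOrderedGraph m) → OnEdgeList {n} (Saturated G)
saturated-onEdgeList G (free , semi) =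
  free ∘ relocate , λ {u} {v} → semisaturated-onEdgeList G (λ {u} {v} → semi {u} {v}) {u} {v}

module _ {P : EdgeOrderedGraph n → Set} (resp : OnEdgeList P) (P? : Decidable P) where

  private
    HasGraph : Vec (Fin n × Fin n) s → Set
    HasGraph es = Σ[ l ∈ (∀ i → proj₁ (lookup es i) ≢ proj₂ (lookup es i)) ]
      Σ[ d ∈ Injective _≡_ SameEdge (lookup es) ]
      P (record { size = _ ; edges = es ; loopless = l ; distinct = d })

    hasGraph? : (es : Vec (Fin n × Fin n) s) → Dec (HasGraph es)
    hasGraph? es
      with all? (λ i → ¬? (proj₁ (lookup es i) ≟ᶠ proj₂ (lookup es i)))
         | all? (λ i → all? λ j → SameEdge? (lookup es i) (lookup es j) →-dec (i ≟ᶠ j))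
    ... | no ¬l | _     = no λ (l , _) → ¬l l
    ... | yes _ | no ¬d = no λ (_ , d , _) → ¬d λ i j → d {i} {j}
    ... | yes l | yes d = map′ (λ p → l , (λ {i} {j} → d i j) , p) (λ (_ , _ , p) → resp p)
      (P? (record { size = _ ; edges = es ; loopless = l ; distinct = λ {i} {j} → d i j }))

    decode : Fin ((n * n) ^ s) → Vec (Fin n × Fin n) s
    decode k = tabulate (remQuot n ∘ finToFun k)

    encode : Vec (Fin n × Fin n) s → Fin ((n * n) ^ s)
    encode es = funToFin λ i → uncurry combine (lookup es i)

    decode∘encode : (es : Vec (Fin n × Fin n) s) → decode (encode es) ≡ es
    decode∘encode es = trans
      (tabulate-cong λ i → trans (cong (remQuot n) (Finₚ.finToFun-funToFin _ i))
                                 (uncurry Finₚ.remQuot-combine (lookup es i)))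
      (tabulate∘lookup es)

  -- There are finitely many edge lists of a given length, coded by the numbers below `(n * n) ^ s`.
  anyGraphOfSize? : ∀ s → Dec (∃[ H ] P H × size H ≡ s)
  anyGraphOfSize? s = map′
    (λ { (_ , _ , _ , p) → _ , p , refl })
    (λ { (H , p , refl) → encode (edges H) ,
         subst HasGraph (sym (decode∘encode (edges H))) (_ , distinct H , p) })
    (any? λ k → hasGraph? {s} (decode k))

least : {P : ℕ → Set} → Decidable P → ∀ n → P n → ∃[ k ] P k × (∀ j → P j → k ≤ j)
least P? n p with P? 0
least P? n       p | yes p₀ = 0 , p₀ , λ _ _ → z≤n
least P? zero    p | no ¬p₀ = contradiction p ¬p₀
least P? (suc n) p | no ¬p₀ with least (P? ∘ suc) n p
... | k , q , minimal = suc k , q , λ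
  { zero p₀ → contradiction p₀ ¬p₀ ; (suc j) r → s≤s (minimal j r) }

-- The sizes that occur form a decidable set of numbers, so one example suffices to compute the
-- least of them.
minSize : {P : EdgeOrderedGraph n → Set} → OnEdgeList P → Decidable P → ∃ P → ∃ (IsMinSize P)
minSize resp P? (H , p) =
  let k , attained , minimal = least (anyGraphOfSize? resp P?) (size H) (H , p , refl)
  in k , attained , λ H′ p′ → minimal _ (H′ , p′ , refl)

-- Greedy saturation

infix 4 _⊑_

-- Listed pairs are preserved literally, not just up to orientation, because `addEdge` leaves the
-- old entries as they are.
record _⊑_ {n} (H₀ H : EdgeOrderedGraph n) : Set where
  field
    embed    : Fin (size H₀) → Fin (size H)
    preserve : ∀ i → edge H (embed i) ≡ edge H₀ i
    increase : ∀ {i j} → i <ᶠ j → embed i <ᶠ embed j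

module _ (H : EdgeOrderedGraph n) {u v : Fin n} (u≢v : u ≢ v) (¬uv : ¬ Adj H u v)
         (p : Fin (suc (size H))) where

  private H+ = addEdge H u≢v ¬uv p

  edge-added : edge H+ p ≡ (u , v)
  edge-added = insertAt-lookup (edges H) p (u , v)

  edge-punchOut : ∀ {i} (p≢i : p ≢ i) → edge H+ i ≡ edge H (punchOut p≢i)
  edge-punchOut p≢i = trans (cong (edge H+) (sym (Finₚ.punchIn-punchOut p≢i)))
                            (insertAt-punchIn (edges H) p (u , v) (punchOut p≢i))

  ⊑-addEdge : {H₀ : EdgeOrderedGraph n} → H₀ ⊑ H → H₀ ⊑ H+
  ⊑-addEdge ι = record
    { embed    = punchIn p ∘ embed
    ; preserve = λ i → trans (insertAt-punchIn (edges H) p (u , v) (embed i)) (preserve i)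
    ; increase = λ i<j → ℕₚ.≰⇒>
        (ℕₚ.<⇒≱ (increase i<j) ∘ Finₚ.punchIn-cancel-≤ p _ _)
    }
    where open _⊑_ ι

  -- A copy that avoids position `p` pulls back to `H` along `punchOut`, which keeps the order of
  -- the other edges.
  addEdge-free : (G : EdgeOrderedGraph m) → (G -Free) H →
                 ¬ (Σ[ c ∈ Copy G H+ ] Uses c p) → (G -Free) H+
  addEdge-free G free none c = free record
    { vmap      = vmap
    ; injective = injective
    ; emap      = λ i → punchOut (p≢ i)
    ; incidence = λ i → subst (λ e → SameEdge e _) (edge-punchOut (p≢ i)) (incidence i)
    ; monotone  = λ i<j → ℕₚ.≰⇒>
        (ℕₚ.<⇒≱ (monotone i<j) ∘ Finₚ.punchOut-cancel-≤ (p≢ _) (p≢ _))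
    }
    where
    open Copy c
    p≢ : ∀ i → p ≢ emap i
    p≢ i p≡ = none (c , i , sym p≡)

module _ (G : EdgeOrderedGraph m) {H₀ : EdgeOrderedGraph n} where

  private
    -- Each insertion trades one unit of fuel for one edge. With no fuel left, the graph would have
    -- more than `n * n` edges.
    complete : ∀ fuel H → n * n < size H + fuel → (G -Free) H → H₀ ⊑ H →
               ∃[ H′ ] Saturated G H′ × H₀ ⊑ H′
    complete zero H bound _ _ =
      contradiction (subst (n * n <_) (ℕₚ.+-identityʳ _) bound) (ℕₚ.≤⇒≯ (size≤n² H))
    complete (suc fuel) H bound free ι with unblocked? G H
    ... | no blocked = H , (free , λ {u} {v} → blocked⇒semisaturated G H blocked {u} {v}) , ι
    ... | yes (_ , _ , p , u≢v , ¬uv , none) =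
      complete fuel (addEdge H u≢v ¬uv p) (subst (n * n <_) (ℕₚ.+-suc _ _) bound)
        (addEdge-free H u≢v ¬uv p G free none) (⊑-addEdge H u≢v ¬uv p ι)

  saturate : (G -Free) H₀ → ∃[ H ] Saturated G H × H₀ ⊑ H
  saturate free = complete (suc (n * n)) H₀ (ℕₚ.m≤n+m _ _) free
    record { embed = id ; preserve = λ _ → refl ; increase = id }

-- Odd cycles

-- The forward direction of `CyclicallyAdjacent`, with the remainder resolved into an ordinary step
-- and the wrap to 0.
Next : Fin n → Fin n → Set
Next {n} u v = suc (toℕ u) ≡ toℕ v ⊎ suc (toℕ u) ≡ n × toℕ v ≡ 0

mod⇒Next : {u v : Fin (suc n)} → toℕ v ≡ suc (toℕ u) % suc n → Next u v
mod⇒Next {n} {u} eq with ℕₚ.m≤n⇒m<n∨m≡n (Finₚ.toℕ<n u)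
... | inj₁ lt = inj₁ (sym (trans eq (m<n⇒m%n≡m lt)))
... | inj₂ wrap = inj₂ (wrap , trans eq (trans (cong (_% suc n) wrap) (n%n≡0 (suc n))))

Next⇒mod : {u v : Fin (suc n)} → Next u v → toℕ v ≡ suc (toℕ u) % suc n
Next⇒mod {n} {v = v} (inj₁ eq) =
  sym (trans (cong (_% suc n) eq) (m<n⇒m%n≡m (Finₚ.toℕ<n v)))
Next⇒mod {n} (inj₂ (wrap , v≡0)) =
  trans v≡0 (sym (trans (cong (_% suc n) wrap) (n%n≡0 (suc n))))

next : (u : Fin (suc n)) → ∃ (Next u)
next {n} u = fromℕ< (m%n<n (suc (toℕ u)) (suc n)) , mod⇒Next {u = u} (Finₚ.toℕ-fromℕ< _)

Next-functional : {u v w : Fin (suc n)} → Next u v → Next u w → v ≡ w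
Next-functional {u = u} p q =
  Finₚ.toℕ-injective (trans (Next⇒mod {u = u} p) (sym (Next⇒mod {u = u} q)))

Next-injective : {u v w : Fin n} → Next u w → Next v w → u ≡ v
Next-injective {u = u} {v} {w} p q = Finₚ.toℕ-injective (ℕₚ.suc-injective (same p q))
  where
  same : Next u w → Next v w → suc (toℕ u) ≡ suc (toℕ v)
  same (inj₁ p)       (inj₁ q)       = trans p (sym q)
  same (inj₁ p)       (inj₂ (_ , q)) = contradiction (trans p q) λ ()
  same (inj₂ (_ , p)) (inj₁ q)       = contradiction (trans q p) λ ()
  same (inj₂ (p , _)) (inj₂ (q , _)) = trans p (sym q)

-- A closed walk has to wrap. If it does so once, counting its ordinary steps makes the wrap
-- equation say that the cycle has 2 vertices; a vertex wrapped to is 0 and cannot wrap again.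
Next-no-2-cycle : {u v : Fin (3 + n)} → Next u v → Next v u → ⊥
Next-no-2-cycle {u = u} {v} (inj₁ p) (inj₁ q) =
  ℕₚ.<-asym (ℕₚ.≤-reflexive p) (ℕₚ.≤-reflexive q)
Next-no-2-cycle (inj₁ p) (inj₂ (q , r)) rewrite r | sym p with q
... | ()
Next-no-2-cycle (inj₂ (p , r)) (inj₁ q) rewrite r | sym q with p
... | ()
Next-no-2-cycle (inj₂ (p , _)) (inj₂ (_ , r)) rewrite r with p
... | ()

Next-no-3-cycle : {u v w : Fin (4 + n)} → Next u v → Next v w → Next w u → ⊥
Next-no-3-cycle (inj₁ p) (inj₁ q) (inj₁ r) =
  ℕₚ.<-asym (ℕₚ.<-trans (ℕₚ.≤-reflexive p) (ℕₚ.≤-reflexive q)) (ℕₚ.≤-reflexive r)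
Next-no-3-cycle (inj₁ p) (inj₁ q) (inj₂ (r , s)) rewrite s | sym p | sym q with r
... | ()
Next-no-3-cycle (inj₁ p) (inj₂ (q , s)) (inj₁ r) rewrite s | sym r | sym p with q
... | ()
Next-no-3-cycle (inj₂ (p , s)) (inj₁ q) (inj₁ r) rewrite s | sym q | sym r with p
... | ()
Next-no-3-cycle (inj₂ (_ , s)) (inj₂ (q , _)) _ rewrite s with q
... | ()
Next-no-3-cycle _ (inj₂ (_ , s)) (inj₂ (q , _)) rewrite s with q
... | ()
Next-no-3-cycle (inj₂ (p , _)) _ (inj₂ (_ , s)) rewrite s with p
... | ()

-- Colouring an odd cycle by parity.

alternating : Bool → ℕ → Bool
alternating b zero    = b
alternating b (suc j) = not (alternating b j)

alternating-even : ∀ b k → alternating b (2 * k) ≡ b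
alternating-even b zero    = refl
alternating-even b (suc k) rewrite ℕₚ.+-suc k (k + 0) =
  trans (not-involutive _) (alternating-even b k)

-- Colours alternate along the positions 0 to 2k, so the last position has the colour of the first,
-- to which the wrap joins it.
not-2-colourable : ∀ k (c : Fin (suc (2 * k)) → Bool) →
                   (∀ {u v} → Next u v → c u ≢ c v) → ⊥
not-2-colourable k c proper = proper {top} {zero} (inj₂ (cong suc (Finₚ.toℕ-fromℕ< _) , refl))
  (trans (along (2 * k) ℕₚ.≤-refl) (alternating-even (c zero) k))
  where
  top : Fin (suc (2 * k))
  top = fromℕ< ℕₚ.≤-refl
  along : ∀ j (j<m : j < suc (2 * k)) → c (fromℕ< j<m) ≡ alternating (c zero) j
  along zero    j<m = refl
  along (suc j) j<m =
    trans (¬-not (≢-sym (proper {fromℕ< i<m} {fromℕ< j<m} (inj₁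
            (trans (cong suc (Finₚ.toℕ-fromℕ< i<m)) (sym (Finₚ.toℕ-fromℕ< j<m)))))))
          (cong not (along j i<m))
    where i<m = ℕₚ.<-trans (ℕₚ.n<1+n j) j<m

-- Positions after t are shifted by one, so that the parity fails to alternate
-- exactly on the edge following t.
colourCut : ℕ → ℕ → Bool
colourCut t j with j ℕₚ.≤? t
... | yes _ = alternating false j
... | no _  = alternating false (suc j)

module _ (k : ℕ) {t : Fin (suc (2 * k))} where

  private
    colour : Fin (suc (2 * k)) → Bool
    colour = colourCut (toℕ t) ∘ toℕ

  -- If `v` is at t + 1, the shift cancels the alternation. If the step wraps, then t = 2k and
  -- nothing is shifted, and both positions are even.
  colourCut-cut : {v : Fin (suc (2 * k))} → Next t v → colour t ≡ colour v
  colourCut-cut {v} nx with toℕ t ℕₚ.≤? toℕ t | toℕ v ℕₚ.≤? toℕ t | nx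
  ... | no t≰t | _       | _      = contradiction ℕₚ.≤-refl t≰t
  ... | yes _  | yes v≤t | inj₁ p = contradiction (subst (_≤ toℕ t) (sym p) v≤t) ℕₚ.1+n≰n
  ... | yes _  | no _    | inj₁ p =
    trans (sym (not-involutive _)) (cong (not ∘ alternating false) p)
  ... | yes _  | no v≰t  | inj₂ (_ , q) = contradiction (subst (_≤ toℕ t) (sym q) z≤n) v≰t
  ... | yes _  | yes _   | inj₂ (p , q) =
    trans (cong (alternating false) (ℕₚ.suc-injective p))
      (trans (alternating-even false k) (sym (cong (alternating false) q)))

  -- An ordinary step stays on one side of the cut and changes parity. In the wrap, `u` = 2k lies
  -- after the cut, so it is shifted to odd parity, while 0 stays even.
  colourCut-proper : {u v : Fin (suc (2 * k))} → u ≢ t → Next u v → colour u ≢ colour v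
  colourCut-proper {u} {v} u≢t nx with toℕ u ℕₚ.≤? toℕ t | toℕ v ℕₚ.≤? toℕ t | nx
  ... | yes _   | yes _   | inj₁ p = λ eq →
    not-¬ refl (trans eq (cong (alternating false) (sym p)))
  ... | yes u≤t | no v≰t  | inj₁ p = contradiction
    (subst (_≤ toℕ t) p (ℕₚ.≤∧≢⇒< u≤t (u≢t ∘ Finₚ.toℕ-injective))) v≰t
  ... | no u≰t  | yes v≤t | inj₁ p = contradiction
    (ℕₚ.≤-trans (ℕₚ.n≤1+n _) (subst (_≤ toℕ t) (sym p) v≤t)) u≰t
  ... | no _    | no _    | inj₁ p = λ eq →
    not-¬ refl (trans eq (cong (alternating false ∘ suc) (sym p)))
  ... | yes u≤t | _       | inj₂ (p , _) = contradiction
    (Finₚ.toℕ-injective (ℕₚ.≤-antisym u≤t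
      (ℕₚ.≤-trans (ℕₚ.≤-pred (Finₚ.toℕ<n t)) (ℕₚ.≤-reflexive (sym (ℕₚ.suc-injective p)))))) u≢t
  ... | no _    | no v≰t  | inj₂ (_ , q) = contradiction (subst (_≤ toℕ t) (sym q) z≤n) v≰t
  ... | no _    | yes _   | inj₂ (p , q) = λ eq → not-¬ refl
    (trans (sym (trans (cong (alternating false) (ℕₚ.suc-injective p)) (alternating-even false k)))
      (trans (sym (not-involutive _)) (cong not (trans eq (cong (alternating false) q)))))

ProperOn : (Fin n → Bool) → Fin n × Fin n → Set
ProperOn c e = c (proj₁ e) ≢ c (proj₂ e)

ProperOn-resp : {c : Fin n → Bool} {e e′ : Fin n × Fin n} →
                SameEdge e e′ → ProperOn c e → ProperOn c e′
ProperOn-resp (inj₁ refl) = id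
ProperOn-resp (inj₂ refl) = ≢-sym

TwoColourable : EdgeOrderedGraph n → Set
TwoColourable {n} H = ∃[ c ] ((i : Fin (size H)) → ProperOn {n} c (edge H i))

-- A colouring pulls back along the vertex map. This is how bipartite graphs are seen to be free of
-- odd cycles.
copy-colourable : {G : EdgeOrderedGraph m} {H : EdgeOrderedGraph n} →
                  Copy G H → TwoColourable H → TwoColourable G
copy-colourable copy (c , proper) =
  c ∘ vmap , λ i → ProperOn-resp {c = c} (incidence i) (proper (emap i))
  where open Copy copy

-- Exchanges the two colours when the reference colour is `true`. In the blow-up, the common vertex
-- set of the two parts needs one and the same colour in both.
normalise : Bool → Bool → Bool
normalise true  = not
normalise false = id

normalise-self : ∀ b → normalise b b ≡ false
normalise-self true  = refl
normalise-self false = refl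

normalise-≢ : ∀ b {x y} → x ≢ y → normalise b x ≢ normalise b y
normalise-≢ false x≢y = x≢y
normalise-≢ true  x≢y eq =
  x≢y (trans (sym (not-involutive _)) (trans (cong not eq) (not-involutive _)))

module Cycle (k : ℕ) (C : EdgeOrderedGraph (suc (2 * k))) (cyc : IsCycle C) where

  private
    M : ℕ
    M = suc (2 * k)

  π = proj₁ cyc

  position : Fin M → Fin M
  position = π ⟨$⟩ˡ_

  position-injective : ∀ {u v} → position u ≡ position v → u ≡ v
  position-injective eq = trans (sym (inverseʳ π)) (trans (cong (π ⟨$⟩ʳ_) eq) (inverseʳ π))

  infix 4 _⇝_
  _⇝_ : Fin M → Fin M → Set
  u ⇝ v = Next (position u) (position v)

  adj⇒arc : ∀ {u v} → Adj C u v → u ⇝ v ⊎ v ⇝ u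
  adj⇒arc {u} {v} uv = [ inj₁ ∘ mod⇒Next {u = position u} , inj₂ ∘ mod⇒Next {u = position v} ]′
    (Equivalence.to (proj₂ cyc (position u) (position v))
      (subst₂ (Adj C) (sym (inverseʳ π)) (sym (inverseʳ π)) uv))

  arc⇒adj : ∀ {u v} → u ⇝ v → Adj C u v
  arc⇒adj {u} {v} a = subst₂ (Adj C) (inverseʳ π) (inverseʳ π)
    (Equivalence.from (proj₂ cyc (position u) (position v))
      (inj₁ (Next⇒mod {u = position u} a)))

  successor : ∀ u → ∃ (u ⇝_)
  successor u = let p , nx = next (position u) in
    π ⟨$⟩ʳ p , subst (Next (position u)) (sym (inverseˡ π)) nx

  arc-functional : ∀ {u v w} → u ⇝ v → u ⇝ w → v ≡ w
  arc-functional {u} p q = position-injective (Next-functional {u = position u} p q)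

  arc-injective : ∀ {u v w} → u ⇝ w → v ⇝ w → u ≡ v
  arc-injective {u} {v} p q = position-injective (Next-injective {u = position u} {position v} p q)

  orient : ∀ i → ∃[ u ] ∃[ v ] u ⇝ v × SameEdge (edge C i) (u , v)
  orient i with adj⇒arc (i , inj₁ refl)
  ... | inj₁ a = _ , _ , a , inj₁ refl
  ... | inj₂ a = _ , _ , a , inj₂ refl

  odd-cycle-not-2-colourable : ¬ TwoColourable C
  odd-cycle-not-2-colourable (c , proper) = not-2-colourable k (c ∘ (π ⟨$⟩ʳ_)) λ {u} {v} nx →
    let i , s = Equivalence.from (proj₂ cyc u v) (inj₁ (Next⇒mod {u = u} nx))
    in ProperOn-resp {c = c} s (proper i)

  -- Without `r` the cycle is a path with 2k edges, and the ends of a path of even length agree in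
  -- its proper colouring.
  path-colouring : ∀ r → ∃[ c ] (∀ i → i ≢ r → ProperOn c (edge C i)) ×
                   c (proj₁ (edge C r)) ≡ false × c (proj₂ (edge C r)) ≡ false
  path-colouring r with x , y , x⇝y , rxy ← orient r =
    (c , proper , proj₁ (ends rxy) , proj₂ (ends rxy))
    where
    c₀ c : Fin M → Bool
    c₀ = colourCut (toℕ (position x)) ∘ toℕ ∘ position
    c  = normalise (c₀ x) ∘ c₀
    cx : c x ≡ false
    cx = normalise-self (c₀ x)
    cy : c y ≡ false
    cy = trans (cong (normalise (c₀ x)) (sym (colourCut-cut k {position x} x⇝y))) cx
    ends : ∀ {e} → SameEdge e (x , y) → c (proj₁ e) ≡ false × c (proj₂ e) ≡ false
    ends (inj₁ refl) = cx , cy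
    ends (inj₂ refl) = cy , cx
    proper : ∀ i → i ≢ r → ProperOn c (edge C i)
    proper i i≢r with u , v , u⇝v , iuv ← orient i =
      ProperOn-resp {c = c} (SameEdge-sym iuv) (normalise-≢ (c₀ x)
        (colourCut-proper k {position x} {position u} (avoid ∘ position-injective) u⇝v))
      where
      -- The only arc leaving `x` is the one along `r`.
      avoid : u ≢ x
      avoid refl with refl ← arc-functional u⇝v x⇝y =
        i≢r (distinct C (SameEdge-trans iuv (SameEdge-sym rxy)))

  complete-3 : k ≡ 1 → ∀ {u v} → u ≢ v → Adj C u v
  complete-3 refl {u} {v} u≢v = subst₂ (Adj C) (inverseʳ π) (inverseʳ π)
    (Equivalence.from (proj₂ cyc (position u) (position v))
      (adjacent (position u) (position v) (u≢v ∘ position-injective)))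
    where
    adjacent : (p q : Fin 3) → p ≢ q → CyclicallyAdjacent p q
    adjacent zero             zero             p≢q = contradiction refl p≢q
    adjacent zero             (suc zero)       _   = inj₁ refl
    adjacent zero             (suc (suc zero)) _   = inj₂ refl
    adjacent (suc zero)       zero             _   = inj₂ refl
    adjacent (suc zero)       (suc zero)       p≢q = contradiction refl p≢q
    adjacent (suc zero)       (suc (suc zero)) _   = inj₁ refl
    adjacent (suc (suc zero)) zero             _   = inj₁ refl
    adjacent (suc (suc zero)) (suc zero)       _   = inj₂ refl
    adjacent (suc (suc zero)) (suc (suc zero)) p≢q = contradiction refl p≢q

  arc-no-2-cycle : 3 ≤ M → ∀ {u v} → u ⇝ v → v ⇝ u → ⊥
  arc-no-2-cycle 3≤M {u} {v} = go 3≤M (position u) (position v)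
    where
    go : 3 ≤ n → (p q : Fin n) → Next p q → Next q p → ⊥
    go (s≤s (s≤s (s≤s _))) p q = Next-no-2-cycle

  arc-no-3-cycle : 4 ≤ M → ∀ {u v w} → u ⇝ v → v ⇝ w → w ⇝ u → ⊥
  arc-no-3-cycle 4≤M {u} {v} {w} = go 4≤M (position u) (position v) (position w)
    where
    go : 4 ≤ n → (p q r : Fin n) → Next p q → Next q r → Next r p → ⊥
    go (s≤s (s≤s (s≤s (s≤s _)))) p q r = Next-no-3-cycle

  -- Either the three arcs form a directed cycle, which is too short, or two of them share a head or
  -- a tail and two vertices coincide.
  triangle-free : 4 ≤ M → ∀ {u v w} → Adj C u v → Adj C v w → Adj C w u → ⊥
  triangle-free 4≤M uv vw wu with adj⇒arc uv | adj⇒arc vw | adj⇒arc wu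
  ... | inj₁ p | inj₁ q | inj₁ r = arc-no-3-cycle 4≤M p q r
  ... | inj₂ p | inj₂ q | inj₂ r = arc-no-3-cycle 4≤M r q p
  ... | inj₁ p | inj₂ q | _      = Adj-irrefl C wu (sym (arc-injective p q))
  ... | inj₂ p | inj₁ q | _      = Adj-irrefl C wu (arc-functional q p)
  ... | _      | inj₁ q | inj₂ r = Adj-irrefl C uv (arc-injective r q)
  ... | _      | inj₂ q | inj₁ r = Adj-irrefl C uv (arc-functional r q)

  -- The arc leaving the head of `i` is a different edge, as it would otherwise run back along `i`.
  linked : 3 ≤ M → ∀ i → ∃[ j ] j ≢ i × (∃[ z ] ∃[ w ] ∃[ w′ ]
           SameEdge (edge C i) (w , z) × SameEdge (edge C j) (z , w′))
  linked 3≤M i with u , v , u⇝v , iuv ← orient i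
    with w , v⇝w ← successor v
    with j , jvw ← arc⇒adj v⇝w =
    j , j≢i , v , u , w , iuv , jvw
    where
    j≢i : j ≢ i
    j≢i refl with SameEdge-trans (SameEdge-sym iuv) jvw
    ... | inj₁ refl = Adj-irrefl C (arc⇒adj u⇝v) refl
    ... | inj₂ refl = arc-no-2-cycle 3≤M u⇝v v⇝w

-- Linear bounds

Linked : EdgeOrderedGraph m → Set
Linked G = ∀ i → ∃[ j ] j ≢ i × (∃[ z ] ∃[ w ] ∃[ w′ ]
  SameEdge (edge G i) (w , z) × SameEdge (edge G j) (z , w′))

module _ (G : EdgeOrderedGraph m) (linked : Linked G) (H : EdgeOrderedGraph n)
         (semi : Semisaturated G H) where

  private
    Isolated : Fin n → Set
    Isolated v = ∀ {i w} → ¬ SameEdge (edge H i) (v , w)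

    -- A vertex is coded by an edge end lying at it; the one extra code is left for an isolated
    -- vertex.
    Code : Fin n → Fin 1 ⊎ (Fin (size H) × Fin 2) → Set
    Code v (inj₁ _)              = Isolated v
    Code v (inj₂ (i , zero))     = proj₁ (edge H i) ≡ v
    Code v (inj₂ (i , suc zero)) = proj₂ (edge H i) ≡ v

    code : ∀ v → ∃ (Code v)
    code v with any? (λ i → proj₁ (edge H i) ≟ᶠ v) | any? (λ i → proj₂ (edge H i) ≟ᶠ v)
    ... | yes (i , p) | _           = inj₂ (i , zero) , p
    ... | no _        | yes (i , p) = inj₂ (i , suc zero) , p
    ... | no ¬p       | no ¬q       = inj₁ zero , λ
      { {i} (inj₁ eq) → ¬p (i , cong proj₁ eq)
      ; {i} (inj₂ eq) → ¬q (i , cong proj₂ eq)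
      }

    -- The new edge plays some edge `i` of `G` in a copy. The edge linked to `i` is then played by
    -- an old edge, which meets `u` or `v`.
    new-edge-touches : ∀ {u v} (u≢v : u ≢ v) (¬uv : ¬ Adj H u v) →
                       Isolated u → Isolated v → ⊥
    new-edge-touches {u} {v} u≢v ¬uv isoᵤ isoᵥ
      with c , i , i↦p ← semi u≢v ¬uv zero
      with j , j≢i , z , w , w′ , iwz , jzw′ ← linked i = meet image-i
      where
      open Copy c
      p≢j : zero ≢ emap j
      p≢j p≡ = j≢i (strictMono⇒injective monotone (sym (trans i↦p p≡)))
      image-i : SameEdge (u , v) (vmap w , vmap z)
      image-i = SameEdge-trans
        (inj₁ (sym (trans (cong (edge (addEdge H u≢v ¬uv zero)) i↦p)
                          (edge-added H u≢v ¬uv zero))))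
        (SameEdge-trans (incidence i) (SameEdge-map vmap iwz))
      image-j : SameEdge (edge H (punchOut p≢j)) (vmap z , vmap w′)
      image-j = SameEdge-trans (inj₁ (sym (edge-punchOut H u≢v ¬uv zero p≢j)))
        (SameEdge-trans (incidence j) (SameEdge-map vmap jzw′))
      meet : SameEdge (u , v) (vmap w , vmap z) → ⊥
      meet (inj₁ eq) = isoᵥ (SameEdge-trans image-j (inj₁ (cong (_, vmap w′) (sym (cong proj₂ eq)))))
      meet (inj₂ eq) = isoᵤ (SameEdge-trans image-j (inj₁ (cong (_, vmap w′) (sym (cong proj₁ eq)))))

    code-injective : ∀ {u v x} → Code u x → Code v x → u ≡ v
    code-injective {u} {v} {inj₁ _} isoᵤ isoᵥ with u ≟ᶠ v
    ... | yes u≡v = u≡v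
    ... | no u≢v  = ⊥-elim (new-edge-touches u≢v (λ (i , s) → isoᵤ s)
      (λ {i} {w} → isoᵤ {i} {w}) (λ {i} {w} → isoᵥ {i} {w}))
    code-injective {x = inj₂ (i , zero)}     p q = trans (sym p) q
    code-injective {x = inj₂ (i , suc zero)} p q = trans (sym p) q

  semisaturated⇒order≤ : n ≤ 1 + size H * 2
  semisaturated⇒order≤ =
    pigeonhole (↔-sym ((↔-id _ ⊎-↔ Finₚ.*↔×) ↔-∘ Finₚ.+↔⊎)) Code code
      λ {u} {v} {x} → code-injective {u} {v} {x}

-- The vertices d ↑ʳ v are the ones between which every further edge
-- completes a copy of G; only d vertices are exceptional.
record Seed (G : EdgeOrderedGraph m) (d w : ℕ) : Set where
  field
    graph : EdgeOrderedGraph (d + w)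
    free  : (G -Free) graph
    force : ∀ {H} (ι : graph ⊑ H) p u v →
            SameEdge (edge H p) (d ↑ʳ u , d ↑ʳ v) →
            (∀ j → _⊑_.embed ι j ≢ p) → Copy G H

module _ {G : EdgeOrderedGraph m} {d w : ℕ} (seed : Seed G d w) where

  open Seed seed

  private
    n′ : ℕ
    n′ = d + w

  -- An edge outside the seed must meet an exceptional vertex, since otherwise `force` yields a
  -- copy. It is coded by that vertex and its other end.
  size≤seed : ∀ {H} → (G -Free) H → graph ⊑ H → size H ≤ size graph + d * n′
  size≤seed {H} H-free ι =
    pigeonhole (↔-sym ((↔-id _ ⊎-↔ Finₚ.*↔×) ↔-∘ Finₚ.+↔⊎)) Code code
      λ {p} {q} {x} → code-injective {p} {q} {x}
    where
    open _⊑_ ι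
    Code : Fin (size H) → Fin (size graph) ⊎ (Fin d × Fin n′) → Set
    Code p (inj₁ j)       = embed j ≡ p
    Code p (inj₂ (x , y)) = SameEdge (edge H p) (x ↑ˡ w , y)

    code-injective : ∀ {p q x} → Code p x → Code q x → p ≡ q
    code-injective {x = inj₁ _} p q = trans (sym p) q
    code-injective {x = inj₂ _} p q = distinct H (SameEdge-trans p (SameEdge-sym q))

    code : ∀ p → ∃ (Code p)
    code p with any? (λ j → embed j ≟ᶠ p)
    ... | yes (j , eq) = inj₁ j , eq
    ... | no new with x , y ← edge H p in eq
                 with splitAt d x in ex | splitAt d y in ey
    ... | inj₁ x′ | _       = inj₂ (x′ , y) , inj₁ (trans eq
                                (cong (_, y) (sym (Finₚ.splitAt⁻¹-↑ˡ ex))))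
    ... | inj₂ _  | inj₁ y′ = inj₂ (y′ , x) , inj₂ (trans eq
                                (cong (x ,_) (sym (Finₚ.splitAt⁻¹-↑ˡ ey))))
    ... | inj₂ x′ | inj₂ y′ = contradiction
      (force ι p x′ y′
        (inj₁ (trans eq (sym (cong₂ _,_ (Finₚ.splitAt⁻¹-↑ʳ ex) (Finₚ.splitAt⁻¹-↑ʳ ey)))))
        (λ j j≡p → new (j , j≡p)))
      H-free

edgeless : ∀ n → EdgeOrderedGraph n
edgeless n = record { size = 0 ; edges = [] ; loopless = λ () ; distinct = λ { {()} } }

module _ (G : EdgeOrderedGraph m) (i₀ : Fin (size G)) (linked : Linked G) where

  private
    -- The edgeless graph is a free starting point, as it has no edge to which `i₀` could be sent.
    saturated-exists : ∀ n → ∃ (Saturated {n = n} G)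
    saturated-exists n =
      let H , satH , _ = saturate G {edgeless n} (λ c → Finₚ.¬Fin0 (Copy.emap c i₀)) in H , satH

    sat : ∀ n → ∃ (Is-sat n G)
    sat n = minSize (saturated-onEdgeList G) (saturated? G) (saturated-exists n)

    ssat : ∀ n → ∃ (Is-ssat n G)
    ssat n = minSize (semisaturated-onEdgeList G) (semisaturated? G)
      (let H , _ , semi = saturated-exists n in H , λ {u} {v} → semi {u} {v})

    -- The summand 1 is absorbed into `s`, which is positive because n is at least 2.
    n≤1+2s⇒n≤3s : ∀ {n s} → 2 ≤ n → n ≤ 1 + s * 2 → n ≤ 3 * s
    n≤1+2s⇒n≤3s {s = zero} 2≤n n≤1 = contradiction (ℕₚ.≤-trans 2≤n n≤1) λ { (s≤s ()) }
    n≤1+2s⇒n≤3s {s = suc s} _ n≤ = ℕₚ.≤-trans n≤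
      (ℕₚ.≤-trans (ℕₚ.+-monoˡ-≤ (suc s * 2) (s≤s (z≤n {s})))
        (ℕₚ.≤-reflexive (trans (cong (suc s +_) (ℕₚ.*-comm (suc s) 2)) refl)))

    linear-lower-bound : (f : ℕ → ℕ) →
      (∀ n → ∃[ H ] Semisaturated {n = n} G H × size H ≡ f n) → (λ n → n) =O f
    linear-lower-bound f attained = 3 , 2 , λ n 2≤n →
      let H , semi , eq = attained n in
      n≤1+2s⇒n≤3s {s = f n} 2≤n (subst (λ s → n ≤ 1 + s * 2) eq
        (semisaturated⇒order≤ G linked H (λ {u} {v} → semi {u} {v})))

    linear-upper-bound : ∀ d c → (∀ w → Σ[ S ∈ Seed G d (suc w) ] size (Seed.graph S) ≤ c * suc w) →
      ∀ n → suc d ≤ n → ∃[ H ] Saturated {n = n} G H × size H ≤ (c + d) * n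
    linear-upper-bound d c seeds n d<n
      -- Requiring more than `d` vertices leaves the set `W` nonempty, with `suc w` elements.
      with w , refl ← ℕₚ.m≤n⇒∃[o]m+o≡n d<n rewrite sym (ℕₚ.+-suc d w) =
      let S , small = seeds w
          H , satH , ι = saturate G (Seed.free S)
      in H , satH , (begin
        size H                                        ≤⟨ size≤seed S (proj₁ satH) ι ⟩
        size (Seed.graph S) + d * (d + suc w)         ≤⟨ ℕₚ.+-monoˡ-≤ _ small ⟩
        c * suc w + d * (d + suc w)                   ≤⟨ ℕₚ.+-monoˡ-≤ _ (ℕₚ.*-monoʳ-≤ c (ℕₚ.m≤n+m (suc w) d)) ⟩
        c * (d + suc w) + d * (d + suc w)             ≡⟨ ℕₚ.*-distribʳ-+ (d + suc w) c d ⟨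
        (c + d) * (d + suc w)                         ∎)
      where open ℕₚ.≤-Reasoning

  -- Saturated graphs are semisaturated, so the same small saturated graphs bound both minima from
  -- above and the isolated-vertex argument bounds both from below.
  seeds⇒Θ : ∀ d c → (∀ w → Σ[ S ∈ Seed G d (suc w) ] size (Seed.graph S) ≤ c * suc w) →
    (∃[ sat ] (∀ n → Is-sat n G (sat n)) × sat =Θ (λ n → n)) ×
    (∃[ ssat ] (∀ n → Is-ssat n G (ssat n)) × ssat =Θ (λ n → n))
  seeds⇒Θ d c seeds =
    (proj₁ ∘ sat , proj₂ ∘ sat ,
      (c + d , suc d , λ n d<n → let H , satH , small = linear-upper-bound d c seeds n d<n in
        ℕₚ.≤-trans (proj₂ (proj₂ (sat n)) H satH) small) ,
      linear-lower-bound (proj₁ ∘ sat) λ n →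
        let _ , (H , (_ , semi) , eq) , _ = sat n in H , (λ {u} {v} → semi {u} {v}) , eq) ,
    (proj₁ ∘ ssat , proj₂ ∘ ssat ,
      (c + d , suc d , λ n d<n → let H , satH , small = linear-upper-bound d c seeds n d<n in
        ℕₚ.≤-trans (proj₂ (proj₂ (ssat n)) H (λ {u} {v} → proj₂ satH {u} {v})) small) ,
      linear-lower-bound (proj₁ ∘ ssat) (proj₁ ∘ proj₂ ∘ ssat))

-- Triangles

third : (x y : Fin 3) → x ≢ y → ∃[ z ] z ≢ x × z ≢ y
third zero             zero             x≢y = contradiction refl x≢y
third zero             (suc zero)       _   = suc (suc zero) , (λ ()) , (λ ())
third zero             (suc (suc zero)) _   = suc zero , (λ ()) , (λ ())
third (suc zero)       zero             _   = suc (suc zero) , (λ ()) , (λ ())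
third (suc zero)       (suc zero)       x≢y = contradiction refl x≢y
third (suc zero)       (suc (suc zero)) _   = zero , (λ ()) , (λ ())
third (suc (suc zero)) zero             _   = suc zero , (λ ()) , (λ ())
third (suc (suc zero)) (suc zero)       _   = zero , (λ ()) , (λ ())
third (suc (suc zero)) (suc (suc zero)) x≢y = contradiction refl x≢y

-- The edge `e x` lies opposite the vertex `t x`, so one index serves for vertices and edges.
IsTriangle : (Fin 3 → Fin n) → (Fin 3 → Fin n × Fin n) → Set
IsTriangle t e = SameEdge (e zero) (t (suc zero) , t (suc (suc zero))) ×
                 SameEdge (e (suc zero)) (t zero , t (suc (suc zero))) ×
                 SameEdge (e (suc (suc zero))) (t zero , t (suc zero))

triangle-edge : {t : Fin 3 → Fin n} {e : Fin 3 → Fin n × Fin n} → IsTriangle t e →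
                ∀ x y z → x ≢ y → x ≢ z → y ≢ z → SameEdge (e x) (t y , t z)
triangle-edge {n} {t} {e} (e₀ , e₁ , e₂) = go
  where
  flip : ∀ {e : Fin n × Fin n} {u v} → SameEdge e (u , v) → SameEdge e (v , u)
  flip s = SameEdge-trans s (inj₂ refl)
  go : ∀ x y z → x ≢ y → x ≢ z → y ≢ z → SameEdge (e x) (t y , t z)
  go zero             (suc zero)       (suc (suc zero)) _ _ _ = e₀
  go zero             (suc (suc zero)) (suc zero)       _ _ _ = flip e₀
  go (suc zero)       zero             (suc (suc zero)) _ _ _ = e₁
  go (suc zero)       (suc (suc zero)) zero             _ _ _ = flip e₁
  go (suc (suc zero)) zero             (suc zero)       _ _ _ = e₂
  go (suc (suc zero)) (suc zero)       zero             _ _ _ = flip e₂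
  go zero             zero             _                p _ _ = contradiction refl p
  go (suc zero)       (suc zero)       _                p _ _ = contradiction refl p
  go (suc (suc zero)) (suc (suc zero)) _                p _ _ = contradiction refl p
  go zero             _                zero             _ q _ = contradiction refl q
  go (suc zero)       _                (suc zero)       _ q _ = contradiction refl q
  go (suc (suc zero)) _                (suc (suc zero)) _ q _ = contradiction refl q
  go _                zero             zero             _ _ r = contradiction refl r
  go _                (suc zero)       (suc zero)       _ _ r = contradiction refl r
  go _                (suc (suc zero)) (suc (suc zero)) _ _ r = contradiction refl r

module _ (C : EdgeOrderedGraph 3) (adjacent : ∀ {u v} → u ≢ v → Adj C u v) where

  private
    opposite : Fin 3 → Fin (size C)
    opposite zero             = proj₁ (adjacent {suc zero} {suc (suc zero)} λ ())
    opposite (suc zero)       = proj₁ (adjacent {zero} {suc (suc zero)} λ ())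
    opposite (suc (suc zero)) = proj₁ (adjacent {zero} {suc zero} λ ())

    opposite-edge : ∀ x y z → x ≢ y → x ≢ z → y ≢ z → SameEdge (edge C (opposite x)) (y , z)
    opposite-edge = triangle-edge {t = id} {e = edge C ∘ opposite}
      (proj₂ (adjacent λ ()) , proj₂ (adjacent λ ()) , proj₂ (adjacent λ ()))

    opposite-injective : Injective _≡_ _≡_ opposite
    opposite-injective {x} {y} eq with x ≟ᶠ y
    ... | yes x≡y = x≡y
    ... | no x≢y with z , z≢x , z≢y ← third x y x≢y
      with SameEdge-trans (SameEdge-sym (opposite-edge x y z x≢y (≢-sym z≢x) (≢-sym z≢y)))
             (SameEdge-trans (inj₁ (cong (edge C) eq))
               (opposite-edge y x z (≢-sym x≢y) (≢-sym z≢y) (≢-sym z≢x)))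
    ... | inj₁ q = contradiction (sym (cong proj₁ q)) x≢y
    ... | inj₂ q = contradiction (sym (cong proj₁ q)) z≢y

    opposite-surjective : ∀ i → ∃[ x ] opposite x ≡ i ×
                          x ≢ proj₁ (edge C i) × x ≢ proj₂ (edge C i)
    opposite-surjective i with x , x≢u , x≢v ← third _ _ (loopless C i) =
      x , distinct C (opposite-edge x _ _ x≢u x≢v (loopless C i)) , x≢u , x≢v

    size≡3 : size C ≡ 3
    size≡3 = ℕₚ.≤-antisym
      (injective⇒≤ {f = proj₁ ∘ opposite-surjective} λ {i} {j} eq →
        trans (sym (proj₁ (proj₂ (opposite-surjective i))))
          (trans (cong opposite eq) (proj₁ (proj₂ (opposite-surjective j)))))
      (injective⇒≤ opposite-injective)

    rank : Fin (size C) → Fin 3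
    rank = cast size≡3

    rank-mono : ∀ {i j} → i <ᶠ j → rank i <ᶠ rank j
    rank-mono = subst₂ _<_ (sym (Finₚ.toℕ-cast size≡3 _)) (sym (Finₚ.toℕ-cast size≡3 _))

    position : Fin 3 → Fin 3
    position = rank ∘ opposite

    position-injective : Injective _≡_ _≡_ position
    position-injective = opposite-injective ∘ strictMono⇒injective rank-mono

  -- All edge-ordered triangles are isomorphic: matching vertices by the rank of their opposite
  -- edges matches the edges in order.
  triangle-copy : (H : EdgeOrderedGraph n) (f : Fin 3 → Fin (size H)) (t : Fin 3 → Fin n) →
                  f zero <ᶠ f (suc zero) → f (suc zero) <ᶠ f (suc (suc zero)) →
                  IsTriangle t (edge H ∘ f) → Copy C H
  triangle-copy {n} H f t f₀<f₁ f₁<f₂ tri = record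
    { vmap      = t ∘ position
    ; injective = position-injective ∘ t-injective
    ; emap      = f ∘ rank
    ; incidence = incidence
    ; monotone  = f-mono ∘ rank-mono
    }
    where
    f-mono : ∀ {i j} → i <ᶠ j → f i <ᶠ f j
    f-mono {zero}     {suc zero}       _ = f₀<f₁
    f-mono {zero}     {suc (suc zero)} _ = Finₚ.<-trans f₀<f₁ f₁<f₂
    f-mono {suc zero} {suc (suc zero)} _ = f₁<f₂
    f-mono {suc zero} {suc zero}       (s≤s ())
    f-mono {suc (suc zero)} {suc zero} (s≤s ())
    f-mono {suc (suc zero)} {suc (suc zero)} (s≤s (s≤s ()))

    t-injective : ∀ {x y} → t x ≡ t y → x ≡ y
    t-injective {x} {y} eq with x ≟ᶠ y
    ... | yes x≡y = x≡y
    ... | no x≢y with z , z≢x , z≢y ← third x y x≢y = contradiction eq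
      (Adj-irrefl H (f z , triangle-edge {t = t} {e = edge H ∘ f} tri z x y z≢x z≢y x≢y))

    incidence : ∀ i → SameEdge (edge H (f (rank i)))
                (map (t ∘ position) (t ∘ position) (edge C i))
    incidence i with x , refl , x≢u , x≢v ← opposite-surjective i =
      triangle-edge {t = t} {e = edge H ∘ f} tri _ _ _
        (x≢u ∘ position-injective) (x≢v ∘ position-injective)
        (loopless C (opposite x) ∘ position-injective)

  private
    star : ∀ w → EdgeOrderedGraph (suc w)
    star w = record
      { size     = w
      ; edges    = tabulate spoke
      ; loopless = λ i → subst (λ e → proj₁ e ≢ proj₂ e) (sym (lookup∘tabulate spoke i)) λ ()
      ; distinct = λ {i} {j} s → spoke-injective
          (subst₂ SameEdge (lookup∘tabulate spoke i) (lookup∘tabulate spoke j) s)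
      }
      where
      spoke : Fin w → Fin (suc w) × Fin (suc w)
      spoke i = zero , suc i
      spoke-injective : ∀ {i j} → SameEdge (spoke i) (spoke j) → i ≡ j
      spoke-injective (inj₁ refl) = refl

    star-edge : ∀ w i → edge (star w) i ≡ (zero , suc i)
    star-edge w = lookup∘tabulate _

    centre : ∀ {w} → Fin (suc w) → Bool
    centre zero    = true
    centre (suc _) = false

    star-colourable : ∀ w → TwoColourable (star w)
    star-colourable w = centre , λ i →
      ProperOn-resp {c = centre} (inj₁ (sym (star-edge w i))) λ ()

  -- An edge between two leaves closes a triangle with their spokes, and a triangle is a copy in
  -- whatever order its edges come. Only the centre is exceptional.
  star-seed : ¬ TwoColourable C → ∀ w → Seed C 1 w
  star-seed odd w = record
    { graph = star w
    ; free  = λ c → odd (copy-colourable c (star-colourable w))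
    ; force = force
    }
    where
    force : ∀ {H} (ι : star w ⊑ H) p u v → SameEdge (edge H p) (suc u , suc v) →
            (∀ j → _⊑_.embed ι j ≢ p) → Copy C H
    -- Spokes are ordered like their leaves, so the ends of the new edge are sorted first.
    force {H} ι p u v uv new = split (Finₚ.<-cmp u v)
      where
      open _⊑_ ι

      spoke : ∀ i → SameEdge (edge H (embed i)) (zero , suc i)
      spoke i = inj₁ (trans (preserve i) (star-edge w i))

      select : {A : Set} → A → A → A → Fin 3 → A
      select x y z zero             = x
      select x y z (suc zero)       = y
      select x y z (suc (suc zero)) = z

      -- The vertices in the second list are opposite to the edges in the first.
      ordered : ∀ {u v} → u <ᶠ v → SameEdge (edge H p) (suc u , suc v) → Copy C H
      ordered {u} {v} u<v uv with Finₚ.<-cmp p (embed u) | Finₚ.<-cmp p (embed v)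
      ... | tri< p<u _ _ | _ = triangle-copy H
        (select p (embed u) (embed v)) (select zero (suc v) (suc u)) p<u (increase u<v)
        (SameEdge-trans uv (inj₂ refl) , spoke u , spoke v)
      ... | tri> _ _ u<p | tri< p<v _ _ = triangle-copy H
        (select (embed u) p (embed v)) (select (suc v) zero (suc u)) u<p p<v
        (spoke u , SameEdge-trans uv (inj₂ refl) , SameEdge-trans (spoke v) (inj₂ refl))
      ... | tri> _ _ _ | tri> _ _ v<p = triangle-copy H
        (select (embed u) (embed v) p) (select (suc v) (suc u) zero) (increase u<v) v<p
        (SameEdge-trans (spoke u) (inj₂ refl) , SameEdge-trans (spoke v) (inj₂ refl) ,
         SameEdge-trans uv (inj₂ refl))
      ... | tri≈ _ p≡ _ | _           = contradiction (sym p≡) (new u)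
      ... | _           | tri≈ _ p≡ _ = contradiction (sym p≡) (new v)

      split : Tri (u <ᶠ v) (u ≡ v) (v <ᶠ u) → Copy C H
      split (tri< u<v _ _)  = ordered u<v uv
      split (tri≈ _ refl _) = contradiction refl (Adj-irrefl H (p , uv))
      split (tri> _ _ v<u)  = ordered v<u (SameEdge-trans uv (inj₂ refl))

-- Longer odd cycles

-- An increasing enumeration of a subset, which turns the active labels into an edge list in label
-- order.
record Selection {N} (A : Fin N → Set) : Set where
  field
    count    : ℕ
    pick     : Fin count → Fin N
    increase : ∀ {i j} → i <ᶠ j → pick i <ᶠ pick j
    sound    : ∀ i → A (pick i)
    complete : ∀ {l} → A l → ∃[ i ] pick i ≡ l

  count≤ : count ≤ N
  count≤ = injective⇒≤ (strictMono⇒injective increase)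

select : ∀ {N} {A : Fin N → Set} → Decidable A → Selection A
select {zero} A? = record
  { count = 0 ; pick = λ () ; increase = λ { {()} } ; sound = λ () ; complete = λ { {()} } }
select {suc N} {A} A? with select (A? ∘ suc) | A? zero
... | rest | no ¬a₀ = record
  { count    = count
  ; pick     = suc ∘ pick
  ; increase = s≤s ∘ increase
  ; sound    = sound
  ; complete = λ
      { {zero}  a₀ → contradiction a₀ ¬a₀
      ; {suc l} a  → let i , eq = complete a in i , cong suc eq
      }
  }
  where open Selection rest
... | rest | yes a₀ = record
  { count    = suc count
  ; pick     = λ { zero → zero ; (suc i) → suc (pick i) }
  ; increase = λ
      { {zero}  {suc j} _         → s≤s z≤n
      ; {suc i} {suc j} (s≤s i<j) → s≤s (increase i<j)
      }
  ; sound    = λ { zero → a₀ ; (suc i) → sound i }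
  ; complete = λ
      { {zero}  _ → zero , refl
      ; {suc l} a → let i , eq = complete a in suc i , cong suc eq
      }
  }
  where open Selection rest

PathColouring : (C : EdgeOrderedGraph m) → Fin (size C) → Set
PathColouring C r = ∃[ c ] (∀ i → i ≢ r → ProperOn c (edge C i)) ×
  c (proj₁ (edge C r)) ≡ false × c (proj₂ (edge C r)) ≡ false

-- A label (τ , i , ω) stands for the ω-th edge replacing the edge i of C in the part
-- τ, and labels are ordered lexicographically.  An edge that avoids the ends of r τ
-- occurs only once, with ω = 0.  The vertices inner τ (x τ) and inner τ (y τ) stay isolated.
module Blowup (C : EdgeOrderedGraph m) (r : Fin 2 → Fin (size C)) (w′ : ℕ)
  (triangle-free : ∀ {x y z} → Adj C x y → Adj C y z → Adj C z x → ⊥)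
  (path-colouring : ∀ τ → PathColouring C (r τ)) where

  private
    w d : ℕ
    w = suc w′
    d = 2 * m

    x y : Fin 2 → Fin m
    x τ = proj₁ (edge C (r τ))
    y τ = proj₂ (edge C (r τ))

    End : Fin 2 → Fin m → Set
    End τ z = z ≡ x τ ⊎ z ≡ y τ

    End? : ∀ τ z → Dec (End τ z)
    End? τ z = (z ≟ᶠ x τ) ⊎-dec (z ≟ᶠ y τ)

    End-distinct : ∀ {τ z z′} → End τ z → End τ z′ → z ≢ z′ → SameEdge (edge C (r τ)) (z , z′)
    End-distinct (inj₁ refl) (inj₁ refl) z≢z′ = contradiction refl z≢z′
    End-distinct (inj₁ refl) (inj₂ refl) _    = inj₁ refl
    End-distinct (inj₂ refl) (inj₁ refl) _    = inj₂ refl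
    End-distinct (inj₂ refl) (inj₂ refl) z≢z′ = contradiction refl z≢z′

    Hit : Fin (size C) → Fin m → Set
    Hit i z = z ≡ proj₁ (edge C i) ⊎ z ≡ proj₂ (edge C i)

    Hit? : ∀ i z → Dec (Hit i z)
    Hit? i z = (z ≟ᶠ _) ⊎-dec (z ≟ᶠ _)

    Hit-both : ∀ {i z z′} → z ≢ z′ → Hit i z → Hit i z′ → SameEdge (edge C i) (z , z′)
    Hit-both z≢z′ (inj₁ refl) (inj₁ refl) = contradiction refl z≢z′
    Hit-both z≢z′ (inj₁ refl) (inj₂ refl) = inj₁ refl
    Hit-both z≢z′ (inj₂ refl) (inj₁ refl) = inj₂ refl
    Hit-both z≢z′ (inj₂ refl) (inj₂ refl) = contradiction refl z≢z′

    Touch : Fin 2 → Fin (size C) → Set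
    Touch τ i = Hit i (x τ) ⊎ Hit i (y τ)

    untouched : ∀ {τ i z z′} → SameEdge (edge C i) (z , z′) → ¬ End τ z → ¬ End τ z′ → ¬ Touch τ i
    untouched (inj₁ refl) ¬z ¬z′ (inj₁ (inj₁ p)) = ¬z  (inj₁ (sym p))
    untouched (inj₁ refl) ¬z ¬z′ (inj₁ (inj₂ p)) = ¬z′ (inj₁ (sym p))
    untouched (inj₁ refl) ¬z ¬z′ (inj₂ (inj₁ p)) = ¬z  (inj₂ (sym p))
    untouched (inj₁ refl) ¬z ¬z′ (inj₂ (inj₂ p)) = ¬z′ (inj₂ (sym p))
    untouched (inj₂ refl) ¬z ¬z′ (inj₁ (inj₁ p)) = ¬z′ (inj₁ (sym p))
    untouched (inj₂ refl) ¬z ¬z′ (inj₁ (inj₂ p)) = ¬z  (inj₁ (sym p))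
    untouched (inj₂ refl) ¬z ¬z′ (inj₂ (inj₁ p)) = ¬z′ (inj₂ (sym p))
    untouched (inj₂ refl) ¬z ¬z′ (inj₂ (inj₂ p)) = ¬z  (inj₂ (sym p))

    -- Each part has its own inner vertices, while the outer vertices, forming `W`, are shared by
    -- both parts.
    inner : Fin 2 → Fin m → Fin (d + w)
    inner τ z = combine τ z ↑ˡ w

    outer : Fin w → Fin (d + w)
    outer ω = d ↑ʳ ω

    inner-injective : ∀ {τ τ′ z z′} → inner τ z ≡ inner τ′ z′ → τ ≡ τ′ × z ≡ z′
    inner-injective eq = Finₚ.combine-injective _ _ _ _ (Finₚ.↑ˡ-injective w _ _ eq)

    inner≢outer : ∀ τ z ω → inner τ z ≢ outer ω
    inner≢outer τ z ω eq
      with () ← trans (sym (Finₚ.splitAt-↑ˡ d (combine τ z) w))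
                      (trans (cong (splitAt d) eq) (Finₚ.splitAt-↑ʳ d w ω))

    place : Fin 2 → Fin w → Fin m → Fin (d + w)
    place τ ω z with End? τ z
    ... | yes _ = outer ω
    ... | no _  = inner τ z

    placed : ∀ τ ω z → End τ z × place τ ω z ≡ outer ω ⊎ ¬ End τ z × place τ ω z ≡ inner τ z
    placed τ ω z with End? τ z
    ... | yes e = inj₁ (e , refl)
    ... | no ¬e = inj₂ (¬e , refl)

    place-≡ : ∀ {τ τ′ ω ω′ z z′} → place τ ω z ≡ place τ′ ω′ z′ →
              End τ z × End τ′ z′ × ω ≡ ω′ ⊎ ¬ End τ z × ¬ End τ′ z′ × τ ≡ τ′ × z ≡ z′
    place-≡ {τ} {τ′} {ω} {ω′} {z} {z′} eq with placed τ ω z | placed τ′ ω′ z′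
    ... | inj₁ (e , p) | inj₁ (e′ , q) =
      inj₁ (e , e′ , Finₚ.↑ʳ-injective d ω ω′ (trans (sym p) (trans eq q)))
    ... | inj₁ (_ , p) | inj₂ (_ , q) =
      contradiction (trans (sym q) (trans (sym eq) p)) (inner≢outer τ′ z′ ω)
    ... | inj₂ (_ , p) | inj₁ (_ , q) =
      contradiction (trans (sym p) (trans eq q)) (inner≢outer τ z ω′)
    ... | inj₂ (¬e , p) | inj₂ (¬e′ , q) =
      inj₂ (¬e , ¬e′ , inner-injective (trans (sym p) (trans eq q)))

    Label : Set
    Label = Fin 2 × Fin (size C) × Fin w

    N : ℕ
    N = 2 * (size C * w)

    encode : Label → Fin N
    encode (τ , i , ω) = combine τ (combine i ω)

    decode : Fin N → Label
    decode = map id (remQuot w) ∘ remQuot (size C * w)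

    decode-encode : ∀ l → decode (encode l) ≡ l
    decode-encode (τ , i , ω) = trans
      (cong (map id (remQuot w)) (Finₚ.remQuot-combine τ (combine i ω)))
      (cong (τ ,_) (Finₚ.remQuot-combine i ω))

    encode-decode : ∀ l → encode (decode l) ≡ l
    encode-decode l = trans
      (cong (combine (proj₁ (remQuot {2} (size C * w) l)))
        (Finₚ.combine-remQuot {size C} w (proj₂ (remQuot {2} (size C * w) l))))
      (Finₚ.combine-remQuot {2} (size C * w) l)

    Active : Label → Set
    Active (τ , i , ω) = i ≢ r τ × (Touch τ i ⊎ ω ≡ zero)

    Active? : ∀ l → Dec (Active l)
    Active? (τ , i , ω) =
      ¬? (i ≟ᶠ r τ) ×-dec ((Hit? i (x τ) ⊎-dec Hit? i (y τ)) ⊎-dec (ω ≟ᶠ zero))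

    labelEdge : Label → Fin (d + w) × Fin (d + w)
    labelEdge (τ , i , ω) = map (place τ ω) (place τ ω) (edge C i)

    -- Two outer ends would force `i` to be `r τ`. Two inner ends determine the edge, and activity
    -- then fixes ω = 0. The mixed case is `half`.
    labelEdge-injective : ∀ {l l′} → Active l → Active l′ →
                          SameEdge (labelEdge l) (labelEdge l′) → l ≡ l′
    labelEdge-injective {τ , i , ω} {τ′ , i′ , ω′} (i≢r , t) (_ , t′) =
      [ (λ eq → aligned (inj₁ refl) (inj₁ refl) (cong proj₁ eq) (cong proj₂ eq))
      , (λ eq → aligned (inj₁ refl) (inj₂ refl) (cong proj₁ eq) (cong proj₂ eq)) ]′
      where
      half : ∀ {a b a′ b′} → SameEdge (edge C i) (a , b) → SameEdge (edge C i′) (a′ , b′) →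
             End τ a × End τ′ a′ × ω ≡ ω′ → ¬ End τ b × ¬ End τ′ b′ × τ ≡ τ′ × b ≡ b′ →
             (τ , i , ω) ≡ (τ′ , i′ , ω′)
      half {a} {a′ = a′} iab ia′b′ (e , e′ , refl) (_ , _ , refl , refl) with a ≟ᶠ a′
      ... | yes refl = cong (λ j → τ , j , ω) (distinct C (SameEdge-trans iab (SameEdge-sym ia′b′)))
      -- Here `a` and `a′` are the two ends of `r τ`, and `b` is joined to both, which makes a
      -- triangle in `C`.
      ... | no a≢a′ = ⊥-elim (triangle-free (i , iab) (Adj-sym C (i′ , ia′b′))
                        (Adj-sym C (r τ , End-distinct e e′ a≢a′)))

      aligned : ∀ {a b a′ b′} → SameEdge (edge C i) (a , b) → SameEdge (edge C i′) (a′ , b′) →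
                place τ ω a ≡ place τ′ ω′ a′ → place τ ω b ≡ place τ′ ω′ b′ →
                (τ , i , ω) ≡ (τ′ , i′ , ω′)
      aligned {a} {b} {a′} {b′} iab ia′b′ p q
        with place-≡ {τ} {τ′} {ω} {ω′} {a} {a′} p | place-≡ {τ} {τ′} {ω} {ω′} {b} {b′} q
      ... | inj₁ (e , _) | inj₁ (e′ , _) = contradiction
        (distinct C (SameEdge-trans iab (SameEdge-sym
          (End-distinct e e′ (Adj-irrefl C (i , iab)))))) i≢r
      ... | inj₁ ea | inj₂ nb = half iab ia′b′ ea nb
      ... | inj₂ na | inj₁ eb =
        half (SameEdge-trans iab (inj₂ refl)) (SameEdge-trans ia′b′ (inj₂ refl)) eb na
      ... | inj₂ (¬a , ¬a′ , refl , refl) | inj₂ (¬b , ¬b′ , _ , refl) =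
        cong₂ (λ j ω → τ , j , ω) (distinct C (SameEdge-trans iab (SameEdge-sym ia′b′)))
          (trans (only-zero (untouched iab ¬a ¬b) t)
            (sym (only-zero (untouched ia′b′ ¬a′ ¬b′) t′)))
        where
        only-zero : {A B : Set} → ¬ A → A ⊎ B → B
        only-zero ¬a = [ (λ a → contradiction a ¬a) , id ]′

    inner-colour : Fin 2 → Fin m → Bool
    inner-colour τ = proj₁ (path-colouring τ)

    colourSum : Fin d ⊎ Fin w → Bool
    colourSum = [ uncurry inner-colour ∘ remQuot m , (λ _ → false) ]′

    colour : Fin (d + w) → Bool
    colour = colourSum ∘ splitAt d

    -- The two rules agree on the ends of `r τ`, since the path colouring gives them the colour
    -- `false` of the outer vertices.
    colour-place : ∀ τ ω z → colour (place τ ω z) ≡ inner-colour τ z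
    colour-place τ ω z with placed τ ω z
    ... | inj₁ (e , eq) = trans (cong colour eq)
      (trans (cong colourSum (Finₚ.splitAt-↑ʳ d w ω)) (sym (ends e)))
      where
      ends : End τ z → inner-colour τ z ≡ false
      ends (inj₁ refl) = proj₁ (proj₂ (proj₂ (path-colouring τ)))
      ends (inj₂ refl) = proj₂ (proj₂ (proj₂ (path-colouring τ)))
    ... | inj₂ (_ , eq) = trans (cong colour eq)
      (trans (cong colourSum (Finₚ.splitAt-↑ˡ d (combine τ z) w))
             (cong (uncurry inner-colour) (Finₚ.remQuot-combine τ z)))

    labelEdge-proper : ∀ l → Active l → ProperOn colour (labelEdge l)
    labelEdge-proper (τ , i , ω) (i≢r , _) eq = proj₁ (proj₂ (path-colouring τ)) i i≢r
      (trans (sym (colour-place τ ω _)) (trans eq (colour-place τ ω _)))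

    open Selection (select (Active? ∘ decode))

    blowup-edge : Fin count → Fin (d + w) × Fin (d + w)
    blowup-edge = labelEdge ∘ decode ∘ pick

    lookup-edge : ∀ j → lookup (tabulate blowup-edge) j ≡ blowup-edge j
    lookup-edge = lookup∘tabulate blowup-edge

    edge-proper : ∀ j → ProperOn colour (lookup (tabulate blowup-edge) j)
    edge-proper j = ProperOn-resp {c = colour} (inj₁ (sym (lookup-edge j)))
                      (labelEdge-proper _ (sound j))

  blowup : EdgeOrderedGraph (d + w)
  blowup = record
    { size     = count
    ; edges    = tabulate blowup-edge
    -- A loop would have ends of equal colour.
    ; loopless = λ j → edge-proper j ∘ cong colour
    ; distinct = λ {j} {j′} s → strictMono⇒injective increase
        (trans (sym (encode-decode (pick j)))
          (trans (cong encode (labelEdge-injective (sound j) (sound j′)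
                   (subst₂ SameEdge (lookup-edge j) (lookup-edge j′) s)))
                 (encode-decode (pick j′))))
    }

  blowup-colourable : TwoColourable blowup
  blowup-colourable = colour , edge-proper

  blowup-size≤ : size blowup ≤ 2 * size C * w
  blowup-size≤ = subst (count ≤_) (sym (ℕₚ.*-assoc 2 (size C) w)) count≤

  module _ {H : EdgeOrderedGraph (d + w)} (ι : blowup ⊑ H) (p : Fin (size H))
           (u v : Fin w) (uv : SameEdge (edge H p) (outer u , outer v)) where

    open _⊑_ ι renaming (increase to embed-increase)

    private
      u≢v : u ≢ v
      u≢v = Adj-irrefl H (p , uv) ∘ cong outer

      module _ (τ : Fin 2) where

        -- The new edge takes the place of `r τ`. The value carries the case it came from, so that
        -- later proofs can match on it.
        image : ∀ z → ∃[ z′ ] (z ≡ x τ × z′ ≡ outer u ⊎ z ≡ y τ × z′ ≡ outer v ⊎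
                               ¬ End τ z × z′ ≡ inner τ z)
        image z with z ≟ᶠ x τ | z ≟ᶠ y τ
        ... | yes z≡x | _       = outer u , inj₁ (z≡x , refl)
        ... | no _    | yes z≡y = outer v , inj₂ (inj₁ (z≡y , refl))
        ... | no z≢x  | no z≢y  = inner τ z , inj₂ (inj₂ ([ z≢x , z≢y ]′ , refl))

        vmap : Fin m → Fin (d + w)
        vmap = proj₁ ∘ image

        vmap-injective : ∀ {z z′} → vmap z ≡ vmap z′ → z ≡ z′
        vmap-injective {z} {z′} eq with image z | image z′
        ... | _ , inj₁ (p , _)           | _ , inj₁ (q , _)           = trans p (sym q)
        ... | _ , inj₂ (inj₁ (p , _))    | _ , inj₂ (inj₁ (q , _))    = trans p (sym q)
        ... | _ , inj₂ (inj₂ (_ , refl)) | _ , inj₂ (inj₂ (_ , refl)) = proj₂ (inner-injective {τ} {τ} eq)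
        ... | _ , inj₁ (_ , refl)        | _ , inj₂ (inj₁ (_ , refl)) =
          contradiction (Finₚ.↑ʳ-injective d u v eq) u≢v
        ... | _ , inj₂ (inj₁ (_ , refl)) | _ , inj₁ (_ , refl)        =
          contradiction (Finₚ.↑ʳ-injective d u v (sym eq)) u≢v
        ... | _ , inj₁ (_ , refl)        | _ , inj₂ (inj₂ (_ , refl)) =
          contradiction (sym eq) (inner≢outer τ z′ _)
        ... | _ , inj₂ (inj₁ (_ , refl)) | _ , inj₂ (inj₂ (_ , refl)) =
          contradiction (sym eq) (inner≢outer τ z′ _)
        ... | _ , inj₂ (inj₂ (_ , refl)) | _ , inj₁ (_ , refl)        =
          contradiction eq (inner≢outer τ z _)
        ... | _ , inj₂ (inj₂ (_ , refl)) | _ , inj₂ (inj₁ (_ , refl)) =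
          contradiction eq (inner≢outer τ z _)

        -- Selects the copy of `i` that meets the new edge correctly. Precedence of `y τ` is
        -- harmless: an edge at both ends is `r τ` itself, for which no copy is chosen.
        weight : ∀ i → ∃[ ω ] (Hit i (y τ) → ω ≡ v) ×
                 (Hit i (x τ) → ¬ Hit i (y τ) → ω ≡ u) × (¬ Touch τ i → ω ≡ zero)
        weight i with Hit? i (x τ) | Hit? i (y τ)
        ... | _      | yes hy = v , (λ _ → refl) , (λ _ ¬hy → contradiction hy ¬hy) ,
                                (λ ¬t → contradiction (inj₂ hy) ¬t)
        ... | yes hx | no ¬hy = u , (λ hy → contradiction hy ¬hy) , (λ _ _ → refl) ,
                                (λ ¬t → contradiction (inj₁ hx) ¬t)
        ... | no ¬hx | no ¬hy = zero , (λ hy → contradiction hy ¬hy) ,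
                                (λ hx → contradiction hx ¬hx) , (λ _ → refl)

        label : Fin (size C) → Label
        label i = τ , i , proj₁ (weight i)

        label-active : ∀ i → i ≢ r τ → Active (label i)
        label-active i i≢r with Hit? i (x τ) ⊎-dec Hit? i (y τ)
        ... | yes t = i≢r , inj₁ t
        ... | no ¬t = i≢r , inj₂ (proj₂ (proj₂ (proj₂ (weight i))) ¬t)

        place≡vmap : ∀ {i z} → i ≢ r τ → Hit i z → place τ (proj₁ (weight i)) z ≡ vmap z
        place≡vmap {i} {z} i≢r hit
          with image z | placed τ (proj₁ (weight i)) z
        ... | _ , inj₁ (refl , refl) | inj₁ (_ , q) =
          trans q (cong outer (proj₁ (proj₂ (proj₂ (weight i))) hit λ hy →
            i≢r (distinct C (Hit-both (loopless C (r τ)) hit hy))))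
        ... | _ , inj₂ (inj₁ (refl , refl)) | inj₁ (_ , q) =
          trans q (cong outer (proj₁ (proj₂ (weight i)) hit))
        ... | _ , inj₂ (inj₂ (_ , refl))    | inj₂ (_ , q)  = q
        ... | _ , inj₁ (z≡x , _)            | inj₂ (¬e , _) = contradiction (inj₁ z≡x) ¬e
        ... | _ , inj₂ (inj₁ (z≡y , _))     | inj₂ (¬e , _) = contradiction (inj₂ z≡y) ¬e
        ... | _ , inj₂ (inj₂ (¬e , _))      | inj₁ (e , _)  = contradiction e ¬e

        chosen : ∀ {i} → i ≢ r τ → ∃[ j ] pick j ≡ encode (label i)
        chosen {i} i≢r =
          complete (subst Active (sym (decode-encode (label i))) (label-active i i≢r))

        old : ∀ {i} → i ≢ r τ → Fin (size H)
        old i≢r = embed (proj₁ (chosen i≢r))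

        old-edge : ∀ {i} (i≢r : i ≢ r τ) → edge H (old i≢r) ≡ map vmap vmap (edge C i)
        old-edge {i} i≢r = let j , pick-j = chosen i≢r in
          trans (preserve j) (trans (lookup-edge j)
            (trans (cong labelEdge (trans (cong decode pick-j) (decode-encode (label i))))
              (cong₂ _,_ (place≡vmap i≢r (inj₁ refl)) (place≡vmap i≢r (inj₂ refl)))))

        -- Within a part, labels compare first by the edge of `C`, so the choice of weights cannot
        -- disturb the order.
        old-increase : ∀ {i i′} (i≢r : i ≢ r τ) (i′≢r : i′ ≢ r τ) → i <ᶠ i′ → old i≢r <ᶠ old i′≢r
        old-increase {i} {i′} i≢r i′≢r i<i′ = embed-increase (strictMono⇒reflects increase
          (subst₂ _<ᶠ_ (sym (proj₂ (chosen i≢r))) (sym (proj₂ (chosen i′≢r)))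
            (encode-mono (Finₚ.combine-monoˡ-< _ _ i<i′))))
          where
          encode-mono : ∀ {a b : Fin (size C * w)} → a <ᶠ b → combine τ a <ᶠ combine τ b
          encode-mono {a} {b} a<b = subst₂ _<_ (sym (Finₚ.toℕ-combine τ a))
            (sym (Finₚ.toℕ-combine τ b)) (ℕₚ.+-monoʳ-< (size C * w * toℕ τ) a<b)

        -- All that remains to be checked is that `p` lies among the chosen edges as `r τ` lies
        -- among the edges of `C`.
        copy : (∀ {i} (i≢r : i ≢ r τ) → (i <ᶠ r τ → old i≢r <ᶠ p) × (r τ <ᶠ i → p <ᶠ old i≢r)) →
               Copy C H
        copy around = record
          { vmap      = vmap
          ; injective = vmap-injective
          ; emap      = proj₁ ∘ emap
          ; incidence = incidence
          ; monotone  = monotone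
          }
          where
          emap : ∀ i → ∃[ q ] (i ≡ r τ × q ≡ p ⊎ Σ[ i≢r ∈ i ≢ r τ ] q ≡ old i≢r)
          emap i with i ≟ᶠ r τ
          ... | yes i≡r = p , inj₁ (i≡r , refl)
          ... | no i≢r  = old i≢r , inj₂ (i≢r , refl)

          vmap-x : vmap (x τ) ≡ outer u
          vmap-x with image (x τ)
          ... | _ , inj₁ (_ , eq)        = eq
          ... | _ , inj₂ (inj₁ (eq , _)) = contradiction eq (loopless C (r τ))
          ... | _ , inj₂ (inj₂ (¬e , _)) = contradiction (inj₁ refl) ¬e

          vmap-y : vmap (y τ) ≡ outer v
          vmap-y with image (y τ)
          ... | _ , inj₁ (eq , _)        = contradiction (sym eq) (loopless C (r τ))
          ... | _ , inj₂ (inj₁ (_ , eq)) = eq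
          ... | _ , inj₂ (inj₂ (¬e , _)) = contradiction (inj₂ refl) ¬e

          incidence : ∀ i → SameEdge (edge H (proj₁ (emap i))) (map vmap vmap (edge C i))
          incidence i with emap i
          ... | _ , inj₁ (refl , refl) = SameEdge-trans uv (inj₁ (sym (cong₂ _,_ vmap-x vmap-y)))
          ... | _ , inj₂ (i≢r , refl)  = inj₁ (old-edge i≢r)

          monotone : ∀ {i j} → i <ᶠ j → proj₁ (emap i) <ᶠ proj₁ (emap j)
          monotone {i} {j} i<j with emap i | emap j
          ... | _ , inj₁ (refl , refl) | _ , inj₁ (refl , refl) = contradiction i<j (ℕₚ.<-irrefl refl)
          ... | _ , inj₁ (refl , refl) | _ , inj₂ (j≢r , refl)  = proj₂ (around j≢r) i<j
          ... | _ , inj₂ (i≢r , refl)  | _ , inj₁ (refl , refl) = proj₁ (around i≢r) i<j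
          ... | _ , inj₂ (i≢r , refl)  | _ , inj₂ (j≢r , refl)  = old-increase i≢r j≢r i<j

        chosen-part : ∀ {i} (i≢r : i ≢ r τ) → proj₁ (decode (pick (proj₁ (chosen i≢r)))) ≡ τ
        chosen-part {i} i≢r =
          cong proj₁ (trans (cong decode (proj₂ (chosen i≢r))) (decode-encode (label i)))

      parts-ordered : ∀ {j j′} → proj₁ (decode (pick j)) ≡ zero →
                      proj₁ (decode (pick j′)) ≡ suc zero → j <ᶠ j′
      parts-ordered {j} {j′} p₀ p₁ = strictMono⇒reflects increase
        (subst₂ _<ᶠ_ (encode-decode (pick j)) (encode-decode (pick j′))
          (Finₚ.combine-monoˡ-< _ _ (subst₂ _<ᶠ_ (sym p₀) (sym p₁) (s≤s z≤n))))

    -- If some edge of the first part comes after `p`, so does the whole second part, where the new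
    -- edge can be the first of a copy. Otherwise the whole first part comes before `p`, and there
    -- the new edge can be the last.
    blowup-force : (∀ {i} → i ≢ r zero → i <ᶠ r zero) →
                   (∀ {i} → i ≢ r (suc zero) → r (suc zero) <ᶠ i) →
                   (∀ j → embed j ≢ p) → Copy C H
    blowup-force last first new
      with any? (λ j → (proj₁ (decode (pick j)) ≟ᶠ zero) ×-dec (p <ᶠ? embed j))
    ... | yes (j , part₀ , p<j) = copy (suc zero) λ i≢r →
      (λ i<r → contradiction (first i≢r) (ℕₚ.<-asym i<r)) ,
      (λ _ → Finₚ.<-trans p<j (embed-increase (parts-ordered part₀ (chosen-part (suc zero) i≢r))))
    ... | no none = copy zero λ i≢r →
      (λ _ → Finₚ.≤∧≢⇒< (ℕₚ.≮⇒≥ λ p< → none (_ , chosen-part zero i≢r , p<)) (new _)) ,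
      (λ r<i → contradiction (last i≢r) (ℕₚ.<-asym r<i))

-- The last and first edges of the cycle, and the final assembly.

extreme : Fin s → Fin 2 → Fin s
extreme {suc s} _ zero    = fromℕ s
extreme {suc s} _ (suc _) = zero

<extreme : (i₀ : Fin s) → ∀ {i} → i ≢ extreme i₀ zero → i <ᶠ extreme i₀ zero
<extreme {suc s} _ i≢ = Finₚ.≤∧≢⇒< (Finₚ.≤fromℕ _) i≢

extreme< : (i₀ : Fin s) → ∀ {i} → i ≢ extreme i₀ (suc zero) → extreme i₀ (suc zero) <ᶠ i
extreme< {suc s} _ i≢ = ℕₚ.n≢0⇒n>0 (i≢ ∘ Finₚ.toℕ-injective)

blowup-seed : (C : EdgeOrderedGraph m) →
  (∀ {x y z} → Adj C x y → Adj C y z → Adj C z x → ⊥) → (∀ i → PathColouring C i) →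
  ¬ TwoColourable C → Fin (size C) →
  ∀ w → Σ[ S ∈ Seed C (2 * m) (suc w) ] size (Seed.graph S) ≤ 2 * size C * suc w
blowup-seed C triangle-free path-colouring odd i₀ w =
  record
    { graph = blowup
    ; free  = λ c → odd (copy-colourable c blowup-colourable)
    ; force = λ ι p u v uv → blowup-force ι p u v uv (<extreme i₀) (extreme< i₀)
    } , blowup-size≤
  where open Blowup C (extreme i₀) w triangle-free (path-colouring ∘ extreme i₀)

corollary57 : ∀ (k : ℕ) → 1 ≤ k → (C : EdgeOrderedGraph (suc (2 * k))) → IsCycle C →
    (∃[ sat ] (∀ n → Is-sat n C (sat n)) × sat =Θ (λ n → n)) ×
    (∃[ ssat ] (∀ n → Is-ssat n C (ssat n)) × ssat =Θ (λ n → n))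
corollary57 (suc zero) _ C cyc =
  -- The star has one exceptional vertex and one edge per leaf.
  seeds⇒Θ C (proj₁ (complete-3 refl {zero} {suc zero} λ ())) (linked (s≤s (s≤s (s≤s z≤n)))) 1 1
    λ w → star-seed C (complete-3 refl) odd-cycle-not-2-colourable (suc w) ,
          ℕₚ.≤-reflexive (sym (ℕₚ.*-identityˡ (suc w)))
  where open Cycle 1 C cyc
corollary57 (suc (suc k)) _ C cyc =
  -- The exceptional vertices are the inner vertices of the two parts, and each outer vertex
  -- accounts for at most `2 * size C` labels.
  seeds⇒Θ C i₀ (linked (ℕₚ.≤-trans (ℕₚ.n≤1+n 3) 4≤)) (2 * suc (2 * (2 + k))) (2 * size C)
    (blowup-seed C (triangle-free 4≤) path-colouring odd-cycle-not-2-colourable i₀)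
  where
  open Cycle (2 + k) C cyc
  4≤ : 4 ≤ suc (2 * (2 + k))
  4≤ = s≤s (ℕₚ.≤-trans (ℕₚ.n≤1+n 3) (ℕₚ.*-monoʳ-≤ 2 (s≤s (s≤s (z≤n {k})))))
  i₀ : Fin (size C)
  i₀ = proj₁ (arc⇒adj (proj₂ (successor zero)))
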